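{- Let $k\ge3$ and let $\mathbf F$ be a $k$-CNF formula on $n$ variables. If $\mathbf F$ is satisfiable, Schöning's algorithm succeeds in finding a satisfying assignment of $\mathbf F$ within $$O^*\left(\frac{2^n(1-1/k)^n}{N_{\lfloor 2n/k\rfloor}}\right)$$ iterations (with probability $1-o(1)$).
   Context: $\Omega_{\mathbf F}\subseteq\{0,1\}^n$ is the set of satisfying assignments of $\mathbf F$, $d_H$ is Hamming distance, $\mathrm{minPD}(S)=\min_{z_1\neq z_2\in S}d_H(z_1,z_2)$ (with $\mathrm{minPD}(S)=+\infty$ if $|S|=1$). For $r\in\{0,\dots,n\}$, $N_r=\max\{|S|: S\subseteq\Omega_{\mathbf F},\ \mathrm{minPD}(S)\ge r\}$. One iteration of Schöning's algorithm: sample $y\in\{0,1\}^n$ uniformly at random; then repeat $3n$ times: if $y$ satisfies $\mathbf F$, return $y$; otherwise take the first clause $C$ of $\mathbf F$ not satisfied by $y$, pick one of its $k$ variables uniformly at random and flip the value $y$ assigns to it. The algorithm repeats independent iterations until a satisfying assignment is returned. A $k$-CNF formula is a conjunction of clauses, each a disjunction of at most $k$ literals. $k$ is a constant and $O^*$ hides factors polynomial in $n$. -}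

module Defs where

open import Algebra.Definitions.RawMonoid using (sum)
open import Algebra.Definitions.RawSemiring using () renaming (_^_ to pow)
open import Data.Bool.Base using (Bool; true; false; not; if_then_else_)
import Data.Bool.Properties as Bool
open import Data.Fin.Base using (Fin)
import Data.Fin.Properties as Fin
import Data.Integer.Base as ℤ
open import Data.List.Base as List
  using (List; []; _∷_; _++_; length; filter; find; deduplicate; cartesianProduct)
import Data.List.Extrema
import Data.List.Extrema.Nat as Extremaℕ
open import Data.List.Membership.Propositional using (_∈_; lose)
open import Data.List.Membership.Propositional.Properties
  using (∈-map⁺; ∈-++⁺ˡ; ∈-++⁺ʳ; ∈-filter⁺)
open import Data.List.NonEmpty.Base as List⁺ using (List⁺; _∷_; _⁺++⁺_)
open import Data.List.Relation.Unary.All using (All; all?)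
open import Data.List.Relation.Unary.Any using (Any; any?; here; there)
open import Data.Maybe.Base using (Maybe; just; nothing)
open import Data.Nat.Base using (ℕ; zero; suc; _≤_; NonZero; >-nonZero)
import Data.Nat.Base as ℕ
import Data.Nat.DivMod as ℕ
import Data.Nat.Properties as ℕ
open import Data.Product.Base using (∃; _×_; _,_; proj₁; proj₂)
open import Data.Rational.Base
  using (ℚ; 0ℚ; 1ℚ; _*_; _-_; _/_; +-0-rawMonoid; +-*-rawSemiring)
open import Data.Sum.Base using (inj₂)
open import Data.Vec.Base as Vec using (Vec; lookup; updateAt)
open import Data.Vec.Properties using (≡-dec)
open import Relation.Binary.Bundles using (TotalOrder)
open import Relation.Binary.Definitions using (DecidableEquality)
import Relation.Binary.Construct.Add.Supremum.NonStrict as Add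
open import Relation.Binary.PropositionalEquality using (_≡_; refl)
open import Relation.Nullary.Construct.Add.Supremum using (_⁺; [_]; ⊤⁺)
open import Relation.Nullary.Decidable using (Dec; does; yes; no; ¬?)
open import Relation.Nullary.Negation using (contradiction)
open import Relation.Unary using (Decidable)

private
  variable
    A B : Set
    n : ℕ

fromℕ : ℕ → ℚ
fromℕ m = ℤ.+ m / 1

infixr 8 _^_

_^_ : ℚ → ℕ → ℚ
_^_ = pow +-*-rawSemiring

------------------------------------------------------------------------
-- CNF formulas

Assignment : ℕ → Set
Assignment n = Vec Bool n

_≟_ : DecidableEquality (Assignment n)
_≟_ = ≡-dec Bool._≟_

-- (v , true) is the variable v, and (v , false) is its negation.
Literal : ℕ → Set
Literal n = Fin n × Bool

Clause : ℕ → Set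
Clause n = List (Literal n)

CNF : ℕ → Set
CNF n = List (Clause n)

Is_CNF : ℕ → CNF n → Set
Is k CNF F = All (λ C → length C ≤ k) F

infix 4 _⊨ˡ_ _⊨ᶜ_ _⊨_ _⊨ᶜ?_ _⊨?_

_⊨ˡ_ : Assignment n → Literal n → Set
y ⊨ˡ (v , b) = lookup y v ≡ b

_⊨ᶜ_ : Assignment n → Clause n → Set
y ⊨ᶜ C = Any (y ⊨ˡ_) C

_⊨_ : Assignment n → CNF n → Set
y ⊨ F = All (y ⊨ᶜ_) F

_⊨ᶜ?_ : (y : Assignment n) → Decidable (y ⊨ᶜ_)
y ⊨ᶜ? C = any? (λ (v , b) → lookup y v Bool.≟ b) C

_⊨?_ : (y : Assignment n) → Decidable (y ⊨_)
y ⊨? F = all? (y ⊨ᶜ?_) F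

Satisfiable : CNF n → Set
Satisfiable F = ∃ (_⊨ F)

-- Repeated variables count once, so that a uniform choice from this list
-- is a uniform choice of a variable of the clause.
variables : Clause n → List (Fin n)
variables C = deduplicate Fin._≟_ (List.map proj₁ C)

-- All of {0,1}ⁿ, each assignment exactly once.
cube : ∀ n → List⁺ (Assignment n)
cube zero    = Vec.[] ∷ []
cube (suc n) = List⁺.map (false Vec.∷_) (cube n) ⁺++⁺ List⁺.map (true Vec.∷_) (cube n)

Ω : CNF n → List (Assignment n)
Ω {n} F = filter (_⊨? F) (List⁺.toList (cube n))

------------------------------------------------------------------------
-- Packings of satisfying assignments

dH : Assignment n → Assignment n → ℕ
dH x y = Vec.count (λ (a , b) → ¬? (a Bool.≟ b)) (Vec.zip x y)

-- ℕ ⁺ is ℕ with a top element ⊤⁺, playing the role of +∞.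
open Add ℕ._≤_ public using (_≤⁺_; _≤⊤⁺; ≤⁺-dec)

≤⁺-totalOrder : TotalOrder _ _ _
≤⁺-totalOrder = record { isTotalOrder = Add.≤⁺-isTotalOrder-≡ ℕ._≤_ ℕ.≤-isTotalOrder }

minPD : List (Assignment n) → ℕ ⁺
minPD S = min ⊤⁺ (List.map (λ (x , y) → [ dH x y ])
                           (filter (λ (x , y) → ¬? (x ≟ y)) (cartesianProduct S S)))
  where open Data.List.Extrema ≤⁺-totalOrder using (min)

-- The subsets of a duplicate-free list, each listed exactly once.
subsets : List A → List (List A)
subsets []       = [] ∷ []
subsets (x ∷ xs) = List.map (x ∷_) (subsets xs) ++ subsets xs

N : CNF n → ℕ → ℕ
N F r = Extremaℕ.max 0
  (List.map length (filter (λ S → ≤⁺-dec ℕ._≤?_ [ r ] (minPD S)) (subsets (Ω F))))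

private
  []∈subsets : (xs : List A) → [] ∈ subsets xs
  []∈subsets []       = here refl
  []∈subsets (x ∷ xs) = ∈-++⁺ʳ (List.map (x ∷_) (subsets xs)) ([]∈subsets xs)

  singleton∈subsets : {x : A} {xs : List A} → x ∈ xs → (x ∷ []) ∈ subsets xs
  singleton∈subsets {xs = x ∷ xs} (here refl)  = ∈-++⁺ˡ (∈-map⁺ (x ∷_) ([]∈subsets xs))
  singleton∈subsets {xs = y ∷ xs} (there x∈xs) =
    ∈-++⁺ʳ (List.map (y ∷_) (subsets xs)) (singleton∈subsets x∈xs)

  ∈-cube : (x : Assignment n) → x ∈ List⁺.toList (cube n)
  ∈-cube Vec.[]            = here refl
  ∈-cube (false Vec.∷ x) = ∈-++⁺ˡ (∈-map⁺ (false Vec.∷_) (∈-cube x))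
  ∈-cube {suc n} (true Vec.∷ x) =
    ∈-++⁺ʳ (List.map (false Vec.∷_) (List⁺.toList (cube n))) (∈-map⁺ (true Vec.∷_) (∈-cube x))

  minPD-singleton : (r : ℕ) (x : Assignment n) → [ r ] ≤⁺ minPD (x ∷ [])
  minPD-singleton r x with x ≟ x
  ... | yes _  = [ r ] ≤⊤⁺
  ... | no x≢x = contradiction refl x≢x

N-nonZero : (F : CNF n) (r : ℕ) → Satisfiable F → NonZero (N F r)
N-nonZero F r (x , x⊨F) = >-nonZero (Extremaℕ.v≤max⁺ 0 _ (inj₂ (lose
  (∈-map⁺ length (∈-filter⁺ (λ S → ≤⁺-dec ℕ._≤?_ [ r ] (minPD S))
    (singleton∈subsets (∈-filter⁺ (_⊨? F) (∈-cube x) x⊨F))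
    (minPD-singleton r x)))
  ℕ.≤-refl)))

------------------------------------------------------------------------
-- Randomised computations

-- choose m f draws i from Fin (suc m) uniformly, independently of all
-- previous draws, and continues with f i.
data Rand (A : Set) : Set where
  return : A → Rand A
  choose : ∀ m → (Fin (suc m) → Rand A) → Rand A

infixl 1 _>>=_

_>>=_ : Rand A → (A → Rand B) → Rand B
return a   >>= k = k a
choose m f >>= k = choose m (λ i → f i >>= k)

uniform : List⁺ A → Rand A
uniform (x ∷ xs) = choose (length xs) (λ i → return (List.lookup (x ∷ xs) i))

Pr : {P : A → Set} → Rand A → Decidable P → ℚ
Pr (return a)   P? = if does (P? a) then 1ℚ else 0ℚ
Pr (choose m f) P? = (ℤ.+ 1 / suc m) * sum +-0-rawMonoid (λ i → Pr (f i) P?)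

------------------------------------------------------------------------
-- Schöning's algorithm

flip : Assignment n → Fin n → Assignment n
flip y v = updateAt y v not

-- There is nothing to flip in an empty clause (then F is unsatisfiable).
flipOneOf : List (Fin n) → Assignment n → Rand (Assignment n)
flipOneOf []       y = return y
flipOneOf (v ∷ vs) y = uniform (v ∷ vs) >>= λ w → return (flip y w)

firstUnsatisfied : CNF n → Assignment n → Maybe (Clause n)
firstUnsatisfied F y = find (λ C → ¬? (y ⊨ᶜ? C)) F

fix : Maybe (Clause n) → Assignment n → Rand (Assignment n)
fix (just C) y = flipOneOf (variables C) y
fix nothing  y = return y

walk : CNF n → ℕ → Assignment n → Rand (Maybe (Assignment n))
walk F zero    y = return nothing
walk F (suc t) y =
  if does (y ⊨? F) then return (just y)
  else (fix (firstUnsatisfied F y) y >>= walk F t)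

iteration : CNF n → Rand (Maybe (Assignment n))
iteration {n} F = uniform (cube n) >>= walk F (3 ℕ.* n)

-- The algorithm cut off after T iterations.
mutual
  schöning : CNF n → ℕ → Rand (Maybe (Assignment n))
  schöning F zero    = return nothing
  schöning F (suc T) = iteration F >>= retry F T

  retry : CNF n → ℕ → Maybe (Assignment n) → Rand (Maybe (Assignment n))
  retry F T (just y) = return (just y)
  retry F T nothing  = schöning F T

data Succeeds (F : CNF n) : Maybe (Assignment n) → Set where
  found : ∀ {y} → y ⊨ F → Succeeds F (just y)

succeeds? : (F : CNF n) → Decidable (Succeeds F)
succeeds? F nothing  = no λ ()
succeeds? F (just y) with y ⊨? F
... | yes y⊨F = yes (found y⊨F)
... | no ¬y⊨F = no λ { (found y⊨F) → ¬y⊨F y⊨F }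

PrSuccessWithin : ℕ → CNF n → ℚ
PrSuccessWithin T F = Pr (schöning F T) (succeeds? F)

-- 2ⁿ (1 - 1/k)ⁿ / N_⌊2n/k⌋
bound : ∀ k .{{_ : NonZero k}} (F : CNF n) → Satisfiable F → ℚ
bound {n} k F sat =
  fromℕ 2 ^ n * (1ℚ - ℤ.+ 1 / k) ^ n * (ℤ.+ 1 / N F r) {{N-nonZero F r sat}}
  where
  r = (2 ℕ.* n) ℕ./ k

{-# OPTIONS --safe #-}
module Submission where

-- Let r = ⌊2n/k⌋ and let S be a largest r-packing of satisfying assignments.  The spheres of
-- radius ρ = ⌊(r-1)/2⌋ around the points of S are disjoint.  If y is at distance d from a
-- satisfying z, then every step of the walk reaches distance d - 1 with probability at least 1/k
-- and distance at most d + 1 otherwise; the function (k-1)^(-d) (t-3d)⁺ / 3n is subharmonic for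
-- this worst case and at most 1 for t ≤ 3n, so it bounds the probability of success within t steps
-- from below.  As 3ρ ≤ n, one iteration succeeds with probability
--   p ≥ N (n C ρ) (k-1)^(-ρ) / (3 · 2ⁿ).
-- Here (n C ρ) (k-1)^(n-ρ) is, up to a factor n + 1, the largest term of the binomial expansion of
-- ((k-1) + 1)ⁿ, whence p ≥ N kⁿ / (3 (n+1)² 2ⁿ (k-1)ⁿ).  With T p ≥ n + 1 the failure probability
-- (1-p)ᵀ is at most 1 / (1 + T p).

-- Why `3d` and k ≥ 3: for a clause with k variables exactly one of which leads closer, (k-1)^(-d)
-- is harmonic, and reweighting the walk by it reverses the drift. The reweighted distance falls
-- with probability (k-1)/k and grows with probability 1/k, so it drops by (k-2)/k ≥ 1/3 per step on
-- average. With t the number of remaining steps, t - 3d therefore does not decrease in mean, and by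
-- convexity neither does its positive part. This takes the place of a ballot or Stirling estimate
-- for the hitting time. Why 2n/k: (n C i) (k-1)^(n-i), the size of a sphere times its success
-- weight up to a common factor, peaks near i = n/k. Centres about 2n/k apart are what keeps spheres
-- of that radius disjoint, and since one radius carries all but a polynomial factor of the total,
-- spheres can replace balls. The inequalities are cleared of denominators, so that the core of the
-- argument is about natural numbers and truncated subtraction serves as the positive part.

-- The embedding of the natural numbers into the rationals

module Rationals where

  open import Defs
  open import Data.Nat.Base using (ℕ; zero; suc; NonZero)
  import Data.Nat.Base as ℕ
  import Data.Nat.Properties as ℕ
  import Data.Integer.Base as ℤ
  import Data.Integer.Properties as ℤ
  open import Data.Rational.Base using (ℚ; 0ℚ; 1ℚ; _+_; _*_; _/_; _≤_; toℚᵘ; Positive)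
  open import Data.Rational.Properties
  import Data.Rational.Unnormalised.Base as ℚᵘ
  import Data.Rational.Unnormalised.Properties as ℚᵘ
  open import Relation.Binary.PropositionalEquality

  -- Opaque, since conversion checking would otherwise unfold fromℕ m to a gcd computation.
  opaque
    ι : ℕ → ℚ
    ι = fromℕ

    ι≡fromℕ : ∀ m → ι m ≡ fromℕ m
    ι≡fromℕ m = refl

    toℚᵘ-ι : ∀ m → toℚᵘ (ι m) ℚᵘ.≃ ℚᵘ.mkℚᵘ (ℤ.+ m) 0
    toℚᵘ-ι m = toℚᵘ-fromℚᵘ (ℚᵘ.mkℚᵘ (ℤ.+ m) 0)

    ι-zero : ι 0 ≡ 0ℚ
    ι-zero = refl

    ι-one : ι 1 ≡ 1ℚ
    ι-one = refl

    0≤ι : ∀ m → 0ℚ ≤ ι m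
    0≤ι m = nonNegative⁻¹ (ι m) {{normalize-nonNeg m 1}}

    ι-pos : ∀ m .{{_ : NonZero m}} → Positive (ι m)
    ι-pos m = normalize-pos m 1

  -- Arithmetic on normalised fractions passes through a gcd, so the identity is checked on
  -- unnormalised fractions with denominator 1.
  ι-+ : ∀ m n → ι (m ℕ.+ n) ≡ ι m + ι n
  ι-+ m n = toℚᵘ-injective (begin
    toℚᵘ (ι (m ℕ.+ n))                     ≈⟨ toℚᵘ-ι (m ℕ.+ n) ⟩
    ℚᵘ.mkℚᵘ (ℤ.+ (m ℕ.+ n)) 0
      ≈⟨ ℚᵘ.*≡* (cong (ℤ._* ℤ.+ 1) (sym (cong₂ ℤ._+_ (ℤ.*-identityʳ (ℤ.+ m)) (ℤ.*-identityʳ (ℤ.+ n))))) ⟩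
    ℚᵘ.mkℚᵘ (ℤ.+ m) 0 ℚᵘ.+ ℚᵘ.mkℚᵘ (ℤ.+ n) 0   ≈⟨ ℚᵘ.+-cong (toℚᵘ-ι m) (toℚᵘ-ι n) ⟨
    toℚᵘ (ι m) ℚᵘ.+ toℚᵘ (ι n)         ≈⟨ toℚᵘ-homo-+ (ι m) (ι n) ⟨
    toℚᵘ (ι m + ι n)                   ∎)
    where open ℚᵘ.≃-Reasoning

  ι-* : ∀ m n → ι (m ℕ.* n) ≡ ι m * ι n
  ι-* m n = toℚᵘ-injective (begin
    toℚᵘ (ι (m ℕ.* n))                     ≈⟨ toℚᵘ-ι (m ℕ.* n) ⟩
    ℚᵘ.mkℚᵘ (ℤ.+ (m ℕ.* n)) 0                  ≈⟨ ℚᵘ.*≡* (cong (ℤ._* ℤ.+ 1) (ℤ.pos-* m n)) ⟩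
    ℚᵘ.mkℚᵘ (ℤ.+ m) 0 ℚᵘ.* ℚᵘ.mkℚᵘ (ℤ.+ n) 0   ≈⟨ ℚᵘ.*-cong (toℚᵘ-ι m) (toℚᵘ-ι n) ⟨
    toℚᵘ (ι m) ℚᵘ.* toℚᵘ (ι n)         ≈⟨ toℚᵘ-homo-* (ι m) (ι n) ⟨
    toℚᵘ (ι m * ι n)                   ∎)
    where open ℚᵘ.≃-Reasoning

  ι-^ : ∀ m n → ι (m ℕ.^ n) ≡ ι m ^ n
  ι-^ m zero    = ι-one
  ι-^ m (suc n) = trans (ι-* m (m ℕ.^ n)) (cong (ι m *_) (ι-^ m n))

  ι-mono-≤ : ∀ {m n} → m ℕ.≤ n → ι m ≤ ι n
  ι-mono-≤ {m} {n} m≤n = begin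
    ι m                      ≡⟨ +-identityʳ (ι m) ⟨
    ι m + 0ℚ                 ≤⟨ +-monoʳ-≤ (ι m) (0≤ι (n ℕ.∸ m)) ⟩
    ι m + ι (n ℕ.∸ m)    ≡⟨ ι-+ m (n ℕ.∸ m) ⟨
    ι (m ℕ.+ (n ℕ.∸ m))      ≡⟨ cong ι (ℕ.m+[n∸m]≡n m≤n) ⟩
    ι n                      ∎
    where open ≤-Reasoning

  ι-*-inverse : ∀ m .{{_ : NonZero m}} → ι m * (ℤ.+ 1 / m) ≡ 1ℚ
  ι-*-inverse (suc m) = toℚᵘ-injective (begin
    toℚᵘ (ι (suc m) * (ℤ.+ 1 / suc m))            ≈⟨ toℚᵘ-homo-* (ι (suc m)) (ℤ.+ 1 / suc m) ⟩
    toℚᵘ (ι (suc m)) ℚᵘ.* toℚᵘ (ℤ.+ 1 / suc m)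
      ≈⟨ ℚᵘ.*-cong (toℚᵘ-ι (suc m)) (toℚᵘ-fromℚᵘ (ℚᵘ.mkℚᵘ (ℤ.+ 1) m)) ⟩
    ℚᵘ.mkℚᵘ (ℤ.+ suc m) 0 ℚᵘ.* ℚᵘ.mkℚᵘ (ℤ.+ 1) m
      ≈⟨ ℚᵘ.*≡* (cong ℤ.+_ (trans (ℕ.*-identityʳ _)
        (trans (ℕ.*-identityʳ _) (sym (trans (ℕ.*-identityˡ _) (ℕ.*-identityˡ _)))))) ⟩
    ℚᵘ.1ℚᵘ                                            ∎)
    where open ℚᵘ.≃-Reasoning

-- Terms of the binomial expansion of (K + 1)^n and the location of the largest one

module Weights where

  open import Data.Nat.Base
  open import Data.Nat.Properties
  open import Data.Nat.DivMod
  open import Data.Nat.Tactic.RingSolver using (solve-∀)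
  open import Data.Nat.Combinatorics using (_C_; nCk+nC[k+1]≡[n+1]C[k+1])
  open import Data.Sum.Base using (inj₁; inj₂)
  open import Relation.Binary.PropositionalEquality

  -- weight K n i is (n C i) * K ^ (n - i), the i-th term of the expansion of (K + 1) ^ n, given by
  -- Pascal's rule so that no truncated subtraction appears.
  weight : ℕ → ℕ → ℕ → ℕ
  weight K zero    zero    = 1
  weight K zero    (suc i) = 0
  weight K (suc n) zero    = K * weight K n zero
  weight K (suc n) (suc i) = weight K n i + K * weight K n (suc i)

  -- This is (i+1) (n C (i+1)) = (n-i) (n C i) multiplied by K^(n-i), with the subtracted term moved
  -- to the other side. It compares consecutive terms and so locates the peak.
  weight-ratio : ∀ K n i → suc i * K * weight K n (suc i) + i * weight K n i ≡ n * weight K n i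
  weight-ratio K zero    zero    = trans (+-identityʳ _) (*-zeroʳ (1 * K))
  weight-ratio K zero    (suc i) = cong₂ _+_ (*-zeroʳ (suc (suc i) * K)) (*-zeroʳ (suc i))
  weight-ratio K (suc n) zero    = trans (eq K (weight K n 0) (weight K n 1))
    (trans (cong (λ e → K * weight K n 0 + K * e) (weight-ratio K n 0)) (eq′ K n (weight K n 0)))
    where
    eq : ∀ K u v → 1 * K * (u + K * v) + 0 * (K * u) ≡ K * u + K * (1 * K * v + 0 * u)
    eq = solve-∀
    eq′ : ∀ K n u → K * u + K * (n * u) ≡ suc n * (K * u)
    eq′ = solve-∀
  weight-ratio K (suc n) (suc i) = begin
    suc (suc i) * K * (v + K * x) + suc i * (u + K * v)
      ≡⟨ eq K i u v x ⟩
    (suc i * K * v + i * u) + K * (suc (suc i) * K * x + suc i * v) + (u + K * v)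
      ≡⟨ cong₂ (λ a b → a + K * b + (u + K * v)) (weight-ratio K n i) (weight-ratio K n (suc i)) ⟩
    n * u + K * (n * v) + (u + K * v)
      ≡⟨ eq′ K n u v ⟩
    suc n * (u + K * v) ∎
    where
    open ≡-Reasoning
    u = weight K n i
    v = weight K n (suc i)
    x = weight K n (suc (suc i))
    eq : ∀ K i u v x → suc (suc i) * K * (v + K * x) + suc i * (u + K * v)
      ≡ (suc i * K * v + i * u) + K * (suc (suc i) * K * x + suc i * v) + (u + K * v)
    eq = solve-∀
    eq′ : ∀ K n u v → n * u + K * (n * v) + (u + K * v) ≡ suc n * (u + K * v)
    eq′ = solve-∀

  weight-zero : ∀ K {n i} → n < i → weight K n i ≡ 0
  weight-zero K {zero}  {suc i} _         = refl
  weight-zero K {suc n} {suc i} (s≤s n<i)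
    rewrite weight-zero K n<i | weight-zero K (m≤n⇒m≤1+n n<i) = *-zeroʳ K

  -- The closed form of `weight` multiplied by `K ^ i`, which avoids the exponent n - i; both sides
  -- vanish for i > n.
  C*^≡weight*^ : ∀ K n i → (n C i) * K ^ n ≡ weight K n i * K ^ i
  C*^≡weight*^ K zero    zero    = refl
  C*^≡weight*^ K zero    (suc i) = refl
  C*^≡weight*^ K (suc n) zero    =
    trans (eq K (K ^ n)) (trans (cong (K *_) (C*^≡weight*^ K n 0)) (sym (*-assoc K _ 1)))
    where
    eq : ∀ K x → 1 * (K * x) ≡ K * (1 * x)
    eq = solve-∀
  C*^≡weight*^ K (suc n) (suc i) = begin
    (suc n C suc i) * (K * K ^ n)
      ≡⟨ cong (_* (K * K ^ n)) (nCk+nC[k+1]≡[n+1]C[k+1] n i) ⟨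
    ((n C i) + (n C suc i)) * (K * K ^ n)                    ≡⟨ eq K (n C i) (n C suc i) (K ^ n) ⟩
    K * ((n C i) * K ^ n) + K * ((n C suc i) * K ^ n)
      ≡⟨ cong₂ (λ a b → K * a + K * b) (C*^≡weight*^ K n i) (C*^≡weight*^ K n (suc i)) ⟩
    K * (u * K ^ i) + K * (v * (K * K ^ i))                  ≡⟨ eq′ K u v (K ^ i) ⟩
    (u + K * v) * (K * K ^ i)                                ∎
    where
    open ≡-Reasoning
    u = weight K n i
    v = weight K n (suc i)
    eq : ∀ K a b x → (a + b) * (K * x) ≡ K * (a * x) + K * (b * x)
    eq = solve-∀
    eq′ : ∀ K u v x → K * (u * x) + K * (v * (K * x)) ≡ (u + K * v) * (K * x)
    eq′ = solve-∀

  partialSum : (ℕ → ℕ) → ℕ → ℕ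
  partialSum f zero    = 0
  partialSum f (suc m) = partialSum f m + f m

  partialSum-≤ : ∀ {f b} → (∀ i → f i ≤ b) → ∀ m → partialSum f m ≤ m * b
  partialSum-≤     f≤b zero    = z≤n
  partialSum-≤ {b = b} f≤b (suc m) =
    ≤-trans (+-mono-≤ (partialSum-≤ f≤b m) (f≤b m)) (≤-reflexive (+-comm (m * b) b))

  -- Pascal's rule summed along a row. The shifted copy has one term fewer, so a factor K + 1
  -- appears only where the extra term of the other copy vanishes, which happens at the end of the
  -- row.
  partialSum-weight : ∀ K n m →
    partialSum (weight K (suc n)) (suc m) ≡ partialSum (weight K n) m + K * partialSum (weight K n) (suc m)
  partialSum-weight K n zero    = refl
  partialSum-weight K n (suc m) = trans
    (cong (_+ (weight K n m + K * weight K n (suc m))) (partialSum-weight K n m))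
    (eq K (partialSum (weight K n) m) (weight K n m) (weight K n (suc m)))
    where
    eq : ∀ K s u v → s + K * (s + u) + (u + K * v) ≡ s + u + K * (s + u + v)
    eq = solve-∀

  weight-sum : ∀ K n → partialSum (weight K n) (suc n) ≡ suc K ^ n
  weight-sum K zero    = refl
  weight-sum K (suc n) = begin
    partialSum (weight K (suc n)) (suc (suc n))  ≡⟨ partialSum-weight K n (suc n) ⟩
    s + K * (s + weight K n (suc n))
      ≡⟨ cong (λ e → s + K * (s + e)) (weight-zero K (n<1+n n)) ⟩
    s + K * (s + 0)                              ≡⟨ cong (λ e → s + K * e) (+-identityʳ s) ⟩
    suc K * s                                    ≡⟨ cong (suc K *_) (weight-sum K n) ⟩
    suc K ^ suc n                                ∎
    where
    open ≡-Reasoning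
    s = partialSum (weight K n) (suc n)

  module _ (K : ℕ) .{{_ : NonZero K}} (n : ℕ) where
    private w = weight K n

    -- For i ≤ n, `weight-ratio` makes the quotient of consecutive terms (n-i) / ((i+1) K), which is
    -- at least 1 when (i+1)(K+1) ≤ n + 1 and at most 1 when (i+1)(K+1) ≥ n + 1. Comparing
    -- (i+1)(K+1) with n thus decides the direction of each step.
    weight-↑ : ∀ i → suc i * suc K ≤ n → w i ≤ w (suc i)
    weight-↑ i h = *-cancelˡ-≤ (suc i * K) {{m*n≢0 (suc i) K}} (+-cancelʳ-≤ (i * w i) _ _ (begin
      suc i * K * w i + i * w i                  ≤⟨ m≤m+n _ (w i) ⟩
      suc i * K * w i + i * w i + w i            ≡⟨ eq K i (w i) ⟩
      suc i * suc K * w i                        ≤⟨ *-monoˡ-≤ (w i) h ⟩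
      n * w i                                    ≡⟨ weight-ratio K n i ⟨
      suc i * K * w (suc i) + i * w i            ∎))
      where
      open ≤-Reasoning
      eq : ∀ K i u → suc i * K * u + i * u + u ≡ suc i * suc K * u
      eq = solve-∀

    weight-↓ : ∀ i → n < suc i * suc K → w (suc i) ≤ w i
    weight-↓ i h = *-cancelˡ-≤ (suc i * K) {{m*n≢0 (suc i) K}} (+-cancelʳ-≤ (i * w i + w i) _ _ (begin
      suc i * K * w (suc i) + (i * w i + w i)    ≡⟨ +-assoc _ (i * w i) (w i) ⟨
      suc i * K * w (suc i) + i * w i + w i      ≡⟨ cong (_+ w i) (weight-ratio K n i) ⟩
      n * w i + w i                              ≡⟨ +-comm (n * w i) (w i) ⟩
      suc n * w i                                ≤⟨ *-monoˡ-≤ (w i) h ⟩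
      suc i * suc K * w i                        ≡⟨ eq K i (w i) ⟩
      suc i * K * w i + (i * w i + w i)          ∎))
      where
      open ≤-Reasoning
      eq : ∀ K i u → suc i * suc K * u ≡ suc i * K * u + (i * u + u)
      eq = solve-∀

    -- A crude bound for the single step from ρ to ρ + 1: the inequalities ρk ≤ n < (ρ+2)k do not
    -- tell on which side of the peak it lies.
    weight-suc≤ : ∀ i → w (suc i) ≤ n * w i
    weight-suc≤ i = begin
      w (suc i)                        ≤⟨ m≤n*m (w (suc i)) (suc i * K) {{m*n≢0 (suc i) K}} ⟩
      suc i * K * w (suc i)            ≤⟨ m≤m+n _ _ ⟩
      suc i * K * w (suc i) + i * w i  ≡⟨ weight-ratio K n i ⟩
      n * w i                          ∎
      where open ≤-Reasoning

    module _ {ρ} (ρk≤n : ρ * suc K ≤ n) (n<[ρ+2]k : n < suc (suc ρ) * suc K) where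

      weight-below : ∀ d {i} → i + d ≡ ρ → w i ≤ w ρ
      weight-below zero    {i} eq rewrite +-identityʳ i | eq = ≤-refl
      weight-below (suc d) {i} eq =
        ≤-trans (weight-↑ i (≤-trans (*-monoˡ-≤ (suc K) 1+i≤ρ) ρk≤n))
          (weight-below d eq′)
        where
        eq′ : suc i + d ≡ ρ
        eq′ = trans (sym (+-suc i d)) eq
        1+i≤ρ : suc i ≤ ρ
        1+i≤ρ = m+n≤o⇒m≤o (suc i) (≤-reflexive eq′)

      weight-above : ∀ d → w (suc d + ρ) ≤ n * w ρ
      weight-above zero    = weight-suc≤ ρ
      weight-above (suc d) = ≤-trans
        (weight-↓ (suc d + ρ) (<-≤-trans n<[ρ+2]k (*-monoˡ-≤ (suc K) (s≤s (s≤s (m≤n+m ρ d))))))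
        (weight-above d)

      weight≤ : ∀ i → w i ≤ suc n * w ρ
      weight≤ i with <-≤-connex ρ i
      ... | inj₂ i≤ρ = ≤-trans (weight-below (ρ ∸ i) (m+[n∸m]≡n i≤ρ)) (m≤m+n (w ρ) (n * w ρ))
      ... | inj₁ ρ<i = ≤-trans
        (subst (λ j → w j ≤ n * w ρ) eq (weight-above (i ∸ suc ρ)))
        (m≤n+m (n * w ρ) (w ρ))
        where
        eq : suc (i ∸ suc ρ) + ρ ≡ i
        eq = trans (sym (+-suc _ ρ)) (m∸n+n≡m ρ<i)

      -- One factor n + 1 counts the terms of the expansion, the other compares each of them with
      -- the term at ρ.
      ^≤weight : suc K ^ n ≤ suc n * (suc n * w ρ)
      ^≤weight = subst (_≤ suc n * (suc n * w ρ)) (weight-sum K n) (partialSum-≤ weight≤ (suc n))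

  -- r ∸ 1 is truncated: the radius is 0 for r ≤ 1, where distinctness alone separates the centres.
  radius : ℕ → ℕ
  radius r = (r ∸ 1) / 2

  radius-upper : ∀ n k .{{_ : NonZero k}} → radius ((2 * n) / k) * k ≤ n
  radius-upper n k = *-cancelˡ-≤ 2 (begin
    2 * (radius r * k)      ≡⟨ eq (radius r) k ⟩
    radius r * 2 * k        ≤⟨ *-monoˡ-≤ k (m/n*n≤m (r ∸ 1) 2) ⟩
    (r ∸ 1) * k             ≤⟨ *-monoˡ-≤ k (m∸n≤m r 1) ⟩
    r * k                   ≤⟨ m/n*n≤m (2 * n) k ⟩
    2 * n                   ∎)
    where
    open ≤-Reasoning
    r = (2 * n) / k
    eq : ∀ a k → 2 * (a * k) ≡ a * 2 * k
    eq = solve-∀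

  m<[1+m/n]*n : ∀ m n .{{_ : NonZero n}} → m < suc (m / n) * n
  m<[1+m/n]*n m n = begin-strict
    m                      ≡⟨ m≡m%n+[m/n]*n m n ⟩
    m % n + (m / n) * n    <⟨ +-monoˡ-< _ (m%n<n m n) ⟩
    n + (m / n) * n        ∎
    where open ≤-Reasoning

  -- The two roundings, of 2n/k and of (r-1)/2, give r + 1 ≤ 2ρ + 3. Together with `radius-upper`
  -- this leaves only ρ and ρ + 1 as candidates for the peak.
  radius-lower : ∀ n k .{{_ : NonZero k}} → n < suc (suc (radius ((2 * n) / k))) * k
  radius-lower n k = *-cancelˡ-< 2 _ _ (begin-strict
    2 * n                          <⟨ m<[1+m/n]*n (2 * n) k ⟩
    suc r * k
      ≤⟨ *-monoˡ-≤ k (≤-trans (s≤s (m≤n+m∸n r 1)) (s≤s (m<[1+m/n]*n (r ∸ 1) 2))) ⟩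
    -- The odd number 2ρ + 3 is rounded up to 2ρ + 4 so that the factor 2 can be cancelled.
    suc (suc ρ * 2) * k            ≤⟨ *-monoˡ-≤ k (n≤1+n (suc (suc ρ * 2))) ⟩
    suc (suc (suc ρ * 2)) * k      ≡⟨ eq ρ k ⟩
    2 * (suc (suc ρ) * k)          ∎)
    where
    open ≤-Reasoning
    r = (2 * n) / k
    ρ = radius r
    eq : ∀ a k → suc (suc (suc a * 2)) * k ≡ 2 * (suc (suc a) * k)
    eq = solve-∀

-- Hamming spheres, double counting and maximal packings

module Packings where

  open import Defs renaming (_^_ to _^ℚ_)
  open Weights using (radius)
  open import Data.Empty using (⊥)
  open import Data.Bool.Base using (true; false)
  open import Data.Nat.Base
  open import Data.Nat.Properties hiding (_≟_)
  import Data.Nat.Properties as ℕ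
  open import Data.Nat.DivMod using (m/n*n≤m)
  open import Data.Nat.Tactic.RingSolver using (solve-∀)
  open import Data.Nat.Combinatorics using (_C_; nCk+nC[k+1]≡[n+1]C[k+1])
  open import Data.Nat.ListAction using (sum)
  open import Data.Fin.Base using (zero; suc)
  open import Data.List.Base as List using (List; []; _∷_; _++_; map; length; filter)
  open import Data.List.Properties
  open import Data.List.Extrema.Nat using (argmax-sel)
  import Data.List.Extrema
  import Data.List.NonEmpty.Base as List⁺
  open import Data.List.Membership.Propositional using (_∈_)
  open import Data.List.Membership.Propositional.Properties
    using (∈-++⁻; ∈-map⁻; ∈-map⁺; ∈-filter⁻; ∈-filter⁺; ∈-cartesianProduct⁺)
  open import Data.List.Relation.Unary.All as All using (All; []; _∷_)
  open import Data.List.Relation.Unary.All.Properties using (all-filter)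
  open import Data.List.Relation.Unary.AllPairs.Core using ([]; _∷_)
  open import Data.List.Relation.Unary.Any using (here; there)
  open import Data.List.Relation.Unary.Unique.Propositional using (Unique)
  import Data.List.Relation.Unary.Unique.Propositional.Properties as Unique
  open import Data.Product.Base using (∃; _×_; _,_)
  open import Data.Sum.Base using (inj₁; inj₂)
  open import Data.Vec.Base as Vec using (Vec)
  import Data.Vec.Properties as Vec
  open import Function.Base using (id; _∘_)
  open import Relation.Nullary.Decidable using (does; yes; no)
  open import Relation.Nullary.Construct.Add.Supremum using ([_])
  import Relation.Binary.Construct.Add.Supremum.NonStrict as Add
  open import Relation.Nullary.Negation using (contradiction)
  open import Relation.Unary using (Decidable)
  open import Relation.Binary.Definitions using () renaming (Decidable to Decidable₂)
  open import Relation.Binary.PropositionalEquality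

  open import Algebra.Properties.CommutativeSemigroup +-commutativeSemigroup using (x∙yz≈y∙xz)

  private
    variable
      A : Set
      n : ℕ

  dH-triangle : (y z z′ : Assignment n) → dH z z′ ≤ dH y z + dH y z′
  dH-triangle Vec.[]          Vec.[]          Vec.[]           = z≤n
  dH-triangle (false Vec.∷ y) (false Vec.∷ z) (false Vec.∷ z′) = dH-triangle y z z′
  dH-triangle (false Vec.∷ y) (false Vec.∷ z) (true  Vec.∷ z′) =
    ≤-trans (s≤s (dH-triangle y z z′)) (≤-reflexive (sym (+-suc _ _)))
  dH-triangle (false Vec.∷ y) (true  Vec.∷ z) (false Vec.∷ z′) = s≤s (dH-triangle y z z′)
  dH-triangle (false Vec.∷ y) (true  Vec.∷ z) (true  Vec.∷ z′) =
    m≤n⇒m≤1+n (≤-trans (dH-triangle y z z′) (+-monoʳ-≤ _ (n≤1+n _)))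
  dH-triangle (true  Vec.∷ y) (true  Vec.∷ z) (true  Vec.∷ z′) = dH-triangle y z z′
  dH-triangle (true  Vec.∷ y) (true  Vec.∷ z) (false Vec.∷ z′) =
    ≤-trans (s≤s (dH-triangle y z z′)) (≤-reflexive (sym (+-suc _ _)))
  dH-triangle (true  Vec.∷ y) (false Vec.∷ z) (true  Vec.∷ z′) = s≤s (dH-triangle y z z′)
  dH-triangle (true  Vec.∷ y) (false Vec.∷ z) (false Vec.∷ z′) =
    m≤n⇒m≤1+n (≤-trans (dH-triangle y z z′) (+-monoʳ-≤ _ (n≤1+n _)))

  dH≤0⇒≡ : (x y : Assignment n) → dH x y ≤ 0 → x ≡ y
  dH≤0⇒≡ Vec.[]          Vec.[]          _ = refl
  dH≤0⇒≡ (false Vec.∷ x) (false Vec.∷ y) h = cong (false Vec.∷_) (dH≤0⇒≡ x y h)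
  dH≤0⇒≡ (true  Vec.∷ x) (true  Vec.∷ y) h = cong (true Vec.∷_) (dH≤0⇒≡ x y h)

  points : ∀ n → List (Assignment n)
  points n = List⁺.toList (cube n)

  length-cube : ∀ n → length (points n) ≡ 2 ^ n
  length-cube zero    = refl
  length-cube (suc n) = begin
    length (map (false Vec.∷_) ys ++ map (true Vec.∷_) ys)
      ≡⟨ length-++ (map (false Vec.∷_) ys) ⟩
    length (map (false Vec.∷_) ys) + length (map (true Vec.∷_) ys)
      ≡⟨ cong₂ _+_ (length-map _ ys) (length-map _ ys) ⟩
    length ys + length ys
      ≡⟨ cong₂ _+_ (length-cube n) (trans (length-cube n) (sym (+-identityʳ (2 ^ n)))) ⟩
    2 ^ suc n                                                       ∎
    where
    open ≡-Reasoning
    ys = points n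

  length-filter-map : {B : Set} {P : B → Set} (P? : Decidable P) (f : A → B) (xs : List A) →
    length (filter P? (map f xs)) ≡ length (filter (P? ∘ f) xs)
  length-filter-map P? f []       = refl
  length-filter-map P? f (x ∷ xs) with does (P? (f x))
  ... | true  = cong suc (length-filter-map P? f xs)
  ... | false = length-filter-map P? f xs

  sphereSize : Assignment n → ℕ → ℕ
  sphereSize {n} z i = length (filter (λ y → dH y z ℕ.≟ i) (points n))

  sphereSize-∷ : ∀ b (z : Assignment n) i → sphereSize (b Vec.∷ z) i ≡
    length (filter (λ y → dH (false Vec.∷ y) (b Vec.∷ z) ℕ.≟ i) (points n)) +
    length (filter (λ y → dH (true Vec.∷ y) (b Vec.∷ z) ℕ.≟ i) (points n))
  sphereSize-∷ {n} b z i = begin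
    length (filter P? (map (false Vec.∷_) ys ++ map (true Vec.∷_) ys))
      ≡⟨ cong length (filter-++ P? (map (false Vec.∷_) ys) _) ⟩
    length (filter P? (map (false Vec.∷_) ys) ++ filter P? (map (true Vec.∷_) ys))
      ≡⟨ length-++ (filter P? (map (false Vec.∷_) ys)) ⟩
    length (filter P? (map (false Vec.∷_) ys)) + length (filter P? (map (true Vec.∷_) ys))
      ≡⟨ cong₂ _+_ (length-filter-map P? (false Vec.∷_) ys) (length-filter-map P? (true Vec.∷_) ys) ⟩
    _ ∎
    where
    open ≡-Reasoning
    ys = points n
    P? = λ y → dH y (b Vec.∷ z) ℕ.≟ i

  shifted-zero : (z : Assignment n) (ys : List (Assignment n)) →
    length (filter (λ y → suc (dH y z) ℕ.≟ 0) ys) ≡ 0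
  shifted-zero z ys = cong length (filter-none (λ y → suc (dH y z) ℕ.≟ 0) (All.universal (λ _ ()) ys))

  shifted-suc : (z : Assignment n) (i : ℕ) (ys : List (Assignment n)) →
    length (filter (λ y → suc (dH y z) ℕ.≟ suc i) ys) ≡ length (filter (λ y → dH y z ℕ.≟ i) ys)
  shifted-suc z i ys = cong length (filter-≐ _ _ (suc-injective , cong suc) ys)

  -- Split the cube by the first coordinate: points agreeing with `z` there have the whole distance
  -- i left, the others i - 1. This recursion is Pascal's rule.
  sphereSize≡C : (z : Assignment n) (i : ℕ) → sphereSize z i ≡ n C i
  sphereSize≡C {zero}  Vec.[] zero    = refl
  sphereSize≡C {zero}  Vec.[] (suc i) = refl
  sphereSize≡C {suc n} (false Vec.∷ z) zero = trans (sphereSize-∷ false z 0)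
    (cong₂ _+_ (sphereSize≡C z 0) (shifted-zero z (points n)))
  sphereSize≡C {suc n} (true Vec.∷ z) zero = trans (sphereSize-∷ true z 0)
    (cong₂ _+_ (shifted-zero z (points n)) (sphereSize≡C z 0))
  sphereSize≡C {suc n} (false Vec.∷ z) (suc i) = begin
    sphereSize (false Vec.∷ z) (suc i)    ≡⟨ sphereSize-∷ false z (suc i) ⟩
    _
      ≡⟨ cong₂ _+_ (sphereSize≡C z (suc i)) (trans (shifted-suc z i (points n)) (sphereSize≡C z i)) ⟩
    (n C suc i) + (n C i)                 ≡⟨ +-comm (n C suc i) (n C i) ⟩
    (n C i) + (n C suc i)                 ≡⟨ nCk+nC[k+1]≡[n+1]C[k+1] n i ⟩
    suc n C suc i                         ∎
    where open ≡-Reasoning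
  sphereSize≡C {suc n} (true Vec.∷ z) (suc i) = begin
    sphereSize (true Vec.∷ z) (suc i)     ≡⟨ sphereSize-∷ true z (suc i) ⟩
    _
      ≡⟨ cong₂ _+_ (trans (shifted-suc z i (points n)) (sphereSize≡C z i)) (sphereSize≡C z (suc i)) ⟩
    (n C i) + (n C suc i)                 ≡⟨ nCk+nC[k+1]≡[n+1]C[k+1] n i ⟩
    suc n C suc i                         ∎
    where open ≡-Reasoning

  sum-map-const : {f : A → ℕ} {c : ℕ} → (∀ x → f x ≡ c) → ∀ xs → sum (map f xs) ≡ length xs * c
  sum-map-const f≡c []       = refl
  sum-map-const f≡c (x ∷ xs) = cong₂ _+_ (f≡c x) (sum-map-const f≡c xs)

  sum-map-≤ : {f : A → ℕ} → (∀ x → f x ≤ 1) → ∀ xs → sum (map f xs) ≤ length xs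
  sum-map-≤ f≤1 []       = z≤n
  sum-map-≤ f≤1 (x ∷ xs) = +-mono-≤ (f≤1 x) (sum-map-≤ f≤1 xs)

  module _ {B : Set} {R : A → B → Set} (R? : Decidable₂ R) where

    double-count-∷ : ∀ x xs ys →
      sum (map (λ y → length (filter (λ x → R? x y) (x ∷ xs))) ys) ≡
      length (filter (R? x) ys) + sum (map (λ y → length (filter (λ x → R? x y) xs)) ys)
    double-count-∷ x xs []       = refl
    double-count-∷ x xs (y ∷ ys) with does (R? x y) | eq
      where
      c = length (filter (λ x → R? x y) xs)
      a = length (filter (R? x) ys)
      b = sum (map (λ y → length (filter (λ x → R? x y) xs)) ys)
      eq : c + sum (map (λ y → length (filter (λ x → R? x y) (x ∷ xs))) ys) ≡ a + (c + b)
      eq = trans (cong (c +_) (double-count-∷ x xs ys)) (x∙yz≈y∙xz c a b)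
    ... | true  | eq = cong suc eq
    ... | false | eq = eq

    double-count : ∀ xs ys →
      sum (map (λ x → length (filter (R? x) ys)) xs) ≡
      sum (map (λ y → length (filter (λ x → R? x y) xs)) ys)
    double-count []       ys = sym (trans (sum-map-const (λ _ → refl) ys) (*-zeroʳ (length ys)))
    double-count (x ∷ xs) ys = trans
      (cong (length (filter (R? x) ys) +_) (double-count xs ys))
      (sym (double-count-∷ x xs ys))

  length≤1 : {xs : List A} → Unique xs → (∀ {x y} → x ∈ xs → y ∈ xs → x ≡ y) → length xs ≤ 1
  length≤1 []                              _   = z≤n
  length≤1 (_ ∷ [])                        _   = s≤s z≤n
  length≤1 ((x≢y ∷ _) ∷ (_ ∷ _))           eq  = contradiction (eq (here refl) (there (here refl))) x≢y

  record IsPacking (F : CNF n) (r : ℕ) (S : List (Assignment n)) : Set where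
    field
      unique    : Unique S
      satisfies : ∀ {z} → z ∈ S → z ⊨ F
      separated : ∀ {z z′} → z ∈ S → z′ ∈ S → z ≢ z′ → r ≤ dH z z′

  2*radius≤ : ∀ r → radius r + radius r ≤ r ∸ 1
  2*radius≤ r = subst (_≤ r ∸ 1) (eq (radius r)) (m/n*n≤m (r ∸ 1) 2)
    where
    eq : ∀ a → a * 2 ≡ a + a
    eq = solve-∀

  -- For r = 0 the truncated `r ∸ 1` is 0 and the second hypothesis is the conclusion; for r > 0 the
  -- two hypotheses contradict each other.
  below-pred : ∀ r {d} → r ≤ d → d ≤ r ∸ 1 → d ≤ 0
  below-pred zero    _   d≤0 = d≤0
  below-pred (suc r) r<d d≤r = contradiction (<-≤-trans r<d d≤r) (<-irrefl refl)

  nearby : List (Assignment n) → ℕ → Assignment n → ℕ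
  nearby S i y = length (filter (λ z → dH y z ℕ.≟ i) S)

  -- Pairs at distance i are counted from either side. The identity serves twice: for the packing
  -- inequality, and to sum the success probabilities over all starting points.
  nearby-sum : (S : List (Assignment n)) (i : ℕ) →
    sum (map (nearby S i) (points n)) ≡ length S * (n C i)
  nearby-sum {n} S i = trans
    (double-count (λ y z → dH y z ℕ.≟ i) (points n) S)
    (sum-map-const (λ z → sphereSize≡C z i) S)

  nearby≤1 : {F : CNF n} {r : ℕ} {S : List (Assignment n)} → IsPacking F r S →
    ∀ y → nearby S (radius r) y ≤ 1
  nearby≤1 {r = r} {S} packing y = length≤1 (Unique.filter⁺ _ unique) same
    where
    open IsPacking packing
    near? = λ z → dH y z ℕ.≟ radius r
    same : ∀ {z z′} → z ∈ filter near? S → z′ ∈ filter near? S → z ≡ z′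
    same {z} {z′} z∈ z′∈ with z ≟ z′ | ∈-filter⁻ near? {xs = S} z∈ | ∈-filter⁻ near? {xs = S} z′∈
    ... | yes z≡z′ | _ | _ = z≡z′
    ... | no  z≢z′ | z∈S , p | z′∈S , q = dH≤0⇒≡ z z′ (below-pred r (separated z∈S z′∈S z≢z′) close)
      where
      open ≤-Reasoning
      close : dH z z′ ≤ r ∸ 1
      close = begin
        dH z z′              ≤⟨ dH-triangle y z z′ ⟩
        dH y z + dH y z′     ≡⟨ cong₂ _+_ p q ⟩
        radius r + radius r  ≤⟨ 2*radius≤ r ⟩
        r ∸ 1                ∎

  -- The Hamming bound, with spheres in place of balls.
  packing-bound : {F : CNF n} {r : ℕ} {S : List (Assignment n)} → IsPacking F r S →
    length S * (n C radius r) ≤ 2 ^ n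
  packing-bound {n} {r = r} {S} packing = begin
    length S * (n C radius r)                                  ≡⟨ nearby-sum S (radius r) ⟨
    sum (map (nearby S (radius r)) (points n))    ≤⟨ sum-map-≤ (nearby≤1 packing) (points n) ⟩
    length (points n)                             ≡⟨ length-cube n ⟩
    2 ^ n                                                      ∎
    where open ≤-Reasoning

  subsets-All : {P : A → Set} {xs : List A} → All P xs → ∀ {S} → S ∈ subsets xs → All P S
  subsets-All {xs = []}     []         (here refl) = []
  subsets-All {xs = x ∷ xs} (px ∷ pxs) S∈ with ∈-++⁻ (map (x ∷_) (subsets xs)) S∈
  ... | inj₂ S∈ = subsets-All pxs S∈
  ... | inj₁ S∈ with _ , S∈ , refl ← ∈-map⁻ (x ∷_) S∈ = px ∷ subsets-All pxs S∈

  subsets-Unique : {xs : List A} → Unique xs → ∀ {S} → S ∈ subsets xs → Unique S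
  subsets-Unique {xs = []}     []         (here refl) = []
  subsets-Unique {xs = x ∷ xs} (px ∷ pxs) S∈ with ∈-++⁻ (map (x ∷_) (subsets xs)) S∈
  ... | inj₂ S∈ = subsets-Unique pxs S∈
  ... | inj₁ S∈ with _ , S∈ , refl ← ∈-map⁻ (x ∷_) S∈ = subsets-All px S∈ ∷ subsets-Unique pxs S∈

  cube-Unique : ∀ n → Unique (points n)
  cube-Unique zero    = [] ∷ []
  cube-Unique (suc n) = Unique.++⁺
    (Unique.map⁺ Vec.∷-injectiveʳ (cube-Unique n)) (Unique.map⁺ Vec.∷-injectiveʳ (cube-Unique n)) disjoint
    where
    disjoint : ∀ {y} → y ∈ map (false Vec.∷_) (points n) × y ∈ map (true Vec.∷_) (points n) → ⊥
    disjoint (p , q) with ∈-map⁻ (false Vec.∷_) p | ∈-map⁻ (true Vec.∷_) q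
    ... | _ , _ , refl | _ , _ , ()

  minPD-separated : (S : List (Assignment n)) {r : ℕ} → [ r ] ≤⁺ minPD S →
    ∀ {z z′} → z ∈ S → z′ ∈ S → z ≢ z′ → r ≤ dH z z′
  minPD-separated S h z∈S z′∈S z≢z′ = Add.[≤]-injective _≤_ (Add.≤⁺-trans _≤_ ≤-trans h
    (All.lookup (min≤xs _ _) (∈-map⁺ _ (∈-filter⁺ _ (∈-cartesianProduct⁺ z∈S z′∈S) z≢z′))))
    where open Data.List.Extrema ≤⁺-totalOrder using (min≤xs)

  max-packing : (F : CNF n) (r : ℕ) → ∃ λ S → IsPacking F r S × length S ≡ N F r
  max-packing {n} F r with argmax-sel id 0
      (map length (filter (λ S → ≤⁺-dec _≤?_ [ r ] (minPD S)) (subsets (Ω F))))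
  -- The maximum in `N` has default value 0; if this is the value selected, the empty list attains
  -- it.
  ... | inj₁ N≡0 = [] , record { unique = [] ; satisfies = λ () ; separated = λ () } , sym N≡0
  ... | inj₂ N∈ with S , S∈ , N≡ ← ∈-map⁻ length N∈
      with S∈subsets , r≤minPD ← ∈-filter⁻ (λ S → ≤⁺-dec _≤?_ [ r ] (minPD S)) {xs = subsets (Ω F)} S∈
      = S , record
        { unique    = subsets-Unique (Unique.filter⁺ (_⊨? F) (cube-Unique n)) S∈subsets
        ; satisfies = All.lookup (subsets-All (all-filter (_⊨? F) (points n)) S∈subsets)
        ; separated = minPD-separated S r≤minPD
        } , sym N≡

-- Success and failure probabilities, independent repetition, amplification

module Probability where

  open import Defs
  open Rationals
  open import Algebra.Definitions.RawMonoid using (sum)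
  open import Data.Bool.Base using (true; false)
  open import Data.Fin.Base using (Fin; zero; suc)
  import Data.Integer.Base as ℤ
  open import Data.List.Base as List using (List; []; _∷_; length)
  open import Data.List.Relation.Unary.All as All using ([]; _∷_)
  open import Data.Maybe.Base using (Maybe; just; nothing)
  open import Data.Nat.Base using (ℕ; zero; suc; NonZero)
  import Data.Nat.Base as ℕ
  import Data.Nat.Properties as ℕ
  open import Data.Rational.Base
    using (ℚ; 0ℚ; 1ℚ; _+_; _*_; _-_; -_; _/_; _≤_; +-0-rawMonoid; NonNegative; nonNegative)
  open import Data.Rational.Properties
  open import Data.Rational.Solver using (module +-*-Solver)
  open import Data.Sum.Base using (_⊎_; inj₁; inj₂)
  open import Relation.Binary.PropositionalEquality
  open import Relation.Nullary.Decidable using (does; yes; no)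
  open import Relation.Nullary.Negation using (contradiction)
  open import Relation.Unary using (Decidable)

  private
    variable
      A B : Set
      n : ℕ

  Σℚ : ∀ {n} → (Fin n → ℚ) → ℚ
  Σℚ = sum +-0-rawMonoid

  Σℚ-mono-≤ : ∀ n {f g : Fin n → ℚ} → (∀ i → f i ≤ g i) → Σℚ f ≤ Σℚ g
  Σℚ-mono-≤ zero    f≤g = ≤-refl
  Σℚ-mono-≤ (suc n) f≤g = +-mono-≤ (f≤g zero) (Σℚ-mono-≤ n (λ i → f≤g (suc i)))

  Σℚ-zero : ∀ n → Σℚ {n} (λ _ → 0ℚ) ≡ 0ℚ
  Σℚ-zero zero    = refl
  Σℚ-zero (suc n) = trans (+-identityˡ _) (Σℚ-zero n)

  Σℚ-cong : ∀ n {f g : Fin n → ℚ} → (∀ i → f i ≡ g i) → Σℚ f ≡ Σℚ g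
  Σℚ-cong zero    f≡g = refl
  Σℚ-cong (suc n) f≡g = cong₂ _+_ (f≡g zero) (Σℚ-cong n (λ i → f≡g (suc i)))

  Σℚ-* : ∀ n (f : Fin n → ℚ) c → Σℚ (λ i → f i * c) ≡ Σℚ f * c
  Σℚ-* zero    f c = sym (*-zeroˡ c)
  Σℚ-* (suc n) f c = trans (cong (f zero * c +_) (Σℚ-* n (λ i → f (suc i)) c))
    (sym (*-distribʳ-+ c (f zero) _))

  Σℚ-complement : ∀ n (f : Fin n → ℚ) → Σℚ (λ i → 1ℚ - f i) ≡ ι n - Σℚ f
  Σℚ-complement zero    f = cong (_- 0ℚ) (sym ι-zero)
  Σℚ-complement (suc n) f = begin
    1ℚ - f zero + Σℚ (λ i → 1ℚ - f (suc i))
      ≡⟨ cong (1ℚ - f zero +_) (Σℚ-complement n (λ i → f (suc i))) ⟩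
    1ℚ - f zero + (ι n - s)               ≡⟨ eq 1ℚ (f zero) (ι n) s ⟩
    1ℚ + ι n - (f zero + s)
      ≡⟨ cong (_- (f zero + s)) (trans (ι-+ 1 n) (cong (_+ ι n) ι-one)) ⟨
    ι (suc n) - (f zero + s)              ∎
    where
    open ≡-Reasoning
    s = Σℚ (λ i → f (suc i))
    open +-*-Solver
    eq : ∀ a b c d → a - b + (c - d) ≡ a + c - (b + d)
    eq = solve 4 (λ a b c d → a :- b :+ (c :- d) := a :+ c :- (b :+ d)) refl

  total : (A → ℚ) → List A → ℚ
  total f []       = 0ℚ
  total f (x ∷ xs) = f x + total f xs

  Σℚ-lookup : (f : A → ℚ) (xs : List A) → Σℚ (λ i → f (List.lookup xs i)) ≡ total f xs
  Σℚ-lookup f []       = refl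
  Σℚ-lookup f (x ∷ xs) = cong (f x +_) (Σℚ-lookup f xs)

  1/-*-ι : ∀ m .{{_ : NonZero m}} → (ℤ.+ 1 / m) * ι m ≡ 1ℚ
  1/-*-ι m = trans (*-comm (ℤ.+ 1 / m) (ι m)) (ι-*-inverse m)

  1/-nonNeg : ∀ m .{{_ : NonZero m}} → NonNegative (ℤ.+ 1 / m)
  1/-nonNeg m = normalize-nonNeg 1 m

  *-monoˡ-≤ : ∀ {r p q} → 0ℚ ≤ r → p ≤ q → r * p ≤ r * q
  *-monoˡ-≤ {r} 0≤r p≤q = *-monoˡ-≤-nonNeg r {{nonNegative 0≤r}} p≤q

  *-monoʳ-≤ : ∀ {r p q} → 0ℚ ≤ r → p ≤ q → p * r ≤ q * r
  *-monoʳ-≤ {r} 0≤r p≤q = *-monoʳ-≤-nonNeg r {{nonNegative 0≤r}} p≤q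

  0≤1 : 0ℚ ≤ 1ℚ
  0≤1 = subst (0ℚ ≤_) ι-one (0≤ι 1)

  ι-*-cancel-≤ : ∀ m .{{_ : NonZero m}} {p q} → ι m * p ≤ ι m * q → p ≤ q
  ι-*-cancel-≤ m = *-cancelˡ-≤-pos (ι m) {{ι-pos m}}

  module _ {P : A → Set} (P? : Decidable P) where

    0≤Pr : (m : Rand A) → 0ℚ ≤ Pr m P?
    0≤Pr (return a) with does (P? a)
    ... | true  = 0≤1
    ... | false = ≤-refl
    0≤Pr (choose m f) = subst (_≤ Pr (choose m f) P?)
      (trans (cong ((ℤ.+ 1 / suc m) *_) (Σℚ-zero (suc m))) (*-zeroʳ (ℤ.+ 1 / suc m)))
      (*-monoˡ-≤-nonNeg (ℤ.+ 1 / suc m) {{1/-nonNeg (suc m)}} (Σℚ-mono-≤ (suc m) (λ i → 0≤Pr (f i))))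

    Pr-choose : ∀ m (f : Fin (suc m) → Rand A) →
      ι (suc m) * Pr (choose m f) P? ≡ Σℚ (λ i → Pr (f i) P?)
    Pr-choose m f = begin
      ι (suc m) * ((ℤ.+ 1 / suc m) * s)   ≡⟨ *-assoc (ι (suc m)) (ℤ.+ 1 / suc m) s ⟨
      ι (suc m) * (ℤ.+ 1 / suc m) * s     ≡⟨ cong (_* s) (ι-*-inverse (suc m)) ⟩
      1ℚ * s                                  ≡⟨ *-identityˡ s ⟩
      s                                       ∎
      where
      open ≡-Reasoning
      s = Σℚ (λ i → Pr (f i) P?)

    -- The computation on the left is what `uniform (x ∷ xs) >>= k` reduces to; the factor in front
    -- clears the denominator of the uniform choice.
    Pr-uniform : (x : B) (xs : List B) (k : B → Rand A) →
      ι (suc (length xs)) * Pr (choose (length xs) (λ i → k (List.lookup (x ∷ xs) i))) P? ≡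
      total (λ b → Pr (k b) P?) (x ∷ xs)
    Pr-uniform x xs k = trans (Pr-choose (length xs) (λ i → k (List.lookup (x ∷ xs) i)))
      (Σℚ-lookup (λ b → Pr (k b) P?) (x ∷ xs))

    fail : Rand A → ℚ
    fail m = 1ℚ - Pr m P?

    -- Complementation commutes with averaging because the weights sum to 1, so failure obeys the
    -- same recursion as `Pr`.
    fail-choose : ∀ m (f : Fin (suc m) → Rand A) →
      fail (choose m f) ≡ (ℤ.+ 1 / suc m) * Σℚ (λ i → fail (f i))
    fail-choose m f = sym (begin
      a * Σℚ (λ i → fail (f i))       ≡⟨ cong (a *_) (Σℚ-complement (suc m) (λ i → Pr (f i) P?)) ⟩
      a * (ι (suc m) - s)         ≡⟨ eq a (ι (suc m)) s ⟩
      a * ι (suc m) - a * s       ≡⟨ cong (_- a * s) (1/-*-ι (suc m)) ⟩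
      1ℚ - a * s                      ∎)
      where
      open ≡-Reasoning
      a = ℤ.+ 1 / suc m
      s = Σℚ (λ i → Pr (f i) P?)
      open +-*-Solver
      eq : ∀ a b c → a * (b - c) ≡ a * b - a * c
      eq = solve 3 (λ a b c → a :* (b :- c) := a :* b :- a :* c) refl

    0≤fail : (m : Rand A) → 0ℚ ≤ fail m
    0≤fail (return a) with does (P? a)
    ... | true  = ≤-refl
    ... | false = 0≤1
    0≤fail (choose m f) = subst₂ _≤_
      (trans (cong ((ℤ.+ 1 / suc m) *_) (Σℚ-zero (suc m))) (*-zeroʳ (ℤ.+ 1 / suc m)))
      (sym (fail-choose m f))
      (*-monoˡ-≤-nonNeg (ℤ.+ 1 / suc m) {{1/-nonNeg (suc m)}} (Σℚ-mono-≤ (suc m) (λ i → 0≤fail (f i))))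

  Always : (A → Set) → Rand A → Set
  Always P (return a)   = P a
  Always P (choose m f) = ∀ i → Always P (f i)

  Always->>= : {P : B → Set} {k : A → Rand B} → (∀ a → Always P (k a)) → ∀ m → Always P (m >>= k)
  Always->>= p (return a)   = p a
  Always->>= p (choose m f) = λ i → Always->>= p (f i)

  module _ (F : CNF n) where

    -- `retry` stops at whatever assignment it is given. Failure probabilities multiply over
    -- iterations only because an iteration never returns an assignment that violates `F`.
    Sound : Maybe (Assignment n) → Set
    Sound r = r ≡ nothing ⊎ Succeeds F r

    walk-sound : ∀ t y → Always Sound (walk F t y)
    walk-sound zero    y = inj₁ refl
    walk-sound (suc t) y with y ⊨? F
    ... | yes y⊨F = inj₂ (found y⊨F)
    ... | no  _   = Always->>= (walk-sound t) (fix (firstUnsatisfied F y) y)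

    success : Rand (Maybe (Assignment n)) → ℚ
    success m = Pr m (succeeds? F)

    failure : Rand (Maybe (Assignment n)) → ℚ
    failure = fail (succeeds? F)

    success-sat : ∀ {y} → y ⊨ F → success (return (just y)) ≡ 1ℚ
    success-sat {y} y⊨F with succeeds? F (just y)
    ... | yes _ = refl
    ... | no ¬p = contradiction (found y⊨F) ¬p

    -- Independence, by induction on the tree of random choices: a leaf `nothing` hands over to a
    -- fresh run, a leaf with a satisfying assignment makes both sides 0, and averaging is linear.
    failure-retry : ∀ T m → Always Sound m → failure (m >>= retry F T) ≡ failure m * failure (schöning F T)
    failure-retry T (return nothing)  _ = sym (*-identityˡ (failure (schöning F T)))
    failure-retry T (return (just y)) (inj₂ (found y⊨F)) =
      trans lem (sym (trans (cong (_* failure (schöning F T)) lem) (*-zeroˡ (failure (schöning F T)))))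
      where
      lem : failure (return (just y)) ≡ 0ℚ
      lem = cong (1ℚ +_) (cong (-_) (success-sat y⊨F))
    failure-retry T (choose m f) sound = begin
      failure (choose m f >>= retry F T)
        ≡⟨ fail-choose (succeeds? F) m (λ i → f i >>= retry F T) ⟩
      a * Σℚ (λ i → failure (f i >>= retry F T))
        ≡⟨ cong (a *_) (Σℚ-cong (suc m) (λ i → failure-retry T (f i) (sound i))) ⟩
      a * Σℚ (λ i → failure (f i) * v)
        ≡⟨ cong (a *_) (Σℚ-* (suc m) (λ i → failure (f i)) v) ⟩
      a * (Σℚ (λ i → failure (f i)) * v)
        ≡⟨ *-assoc a _ v ⟨
      a * Σℚ (λ i → failure (f i)) * v
        ≡⟨ cong (_* v) (fail-choose (succeeds? F) m f) ⟨
      failure (choose m f) * v ∎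
      where
      open ≡-Reasoning
      a = ℤ.+ 1 / suc m
      v = failure (schöning F T)

    failure-schöning : ∀ T → failure (schöning F T) ≡ failure (iteration F) ^ T
    failure-schöning zero    = refl
    failure-schöning (suc T) = trans
      (failure-retry T (iteration F)
      (Always->>= {P = Sound} {k = walk F (3 ℕ.* n)} (walk-sound (3 ℕ.* n)) (uniform (cube n))))
      (cong (failure (iteration F) *_) (failure-schöning T))

  0≤* : ∀ {p q} → 0ℚ ≤ p → 0ℚ ≤ q → 0ℚ ≤ p * q
  0≤* {p} {q} 0≤p 0≤q = subst (_≤ p * q) (*-zeroʳ p) (*-monoˡ-≤ 0≤p 0≤q)

  0≤^ : ∀ {q} → 0ℚ ≤ q → ∀ T → 0ℚ ≤ q ^ T
  0≤^     0≤q zero    = 0≤1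
  0≤^ {q} 0≤q (suc T) = 0≤* 0≤q (0≤^ 0≤q T)

  -- A rational substitute for (1-p)^T ≤ exp(-Tp). The induction step is (1-p)(1+(T+1)p) = 1 + Tp -
  -- (T+1)p².
  bernoulli : ∀ {p} → 0ℚ ≤ p → 0ℚ ≤ 1ℚ - p → ∀ T → (1ℚ - p) ^ T * (1ℚ + ι T * p) ≤ 1ℚ
  bernoulli {p} 0≤p 0≤q zero    = ≤-reflexive (trans (*-identityˡ _)
    (trans (cong (λ e → 1ℚ + e * p) ι-zero) (trans (cong (1ℚ +_) (*-zeroˡ p)) refl)))
  bernoulli {p} 0≤p 0≤q (suc T) = begin
    q * q ^ T * (1ℚ + ι (suc T) * p)
      ≡⟨ cong (λ e → q * q ^ T * (1ℚ + e * p)) (trans (ι-+ 1 T) (cong (_+ t) ι-one)) ⟩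
    q * q ^ T * (1ℚ + (1ℚ + t) * p)                             ≡⟨ eq p (q ^ T) t ⟩
    q ^ T * (1ℚ + t * p) - q ^ T * ((1ℚ + t) * (p * p))
      ≤⟨ +-monoʳ-≤ (q ^ T * (1ℚ + t * p)) (neg-antimono-≤ 0≤rest) ⟩
    q ^ T * (1ℚ + t * p) - 0ℚ                                   ≡⟨ +-identityʳ _ ⟩
    q ^ T * (1ℚ + t * p)                                        ≤⟨ bernoulli 0≤p 0≤q T ⟩
    1ℚ                                                          ∎
    where
    open ≤-Reasoning
    q = 1ℚ - p
    t = ι T
    0≤rest : 0ℚ ≤ q ^ T * ((1ℚ + t) * (p * p))
    0≤rest = 0≤* (0≤^ 0≤q T) (0≤* (+-mono-≤ (0≤1) (0≤ι T)) (0≤* 0≤p 0≤p))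
    open +-*-Solver
    eq : ∀ p x t → (1ℚ - p) * x * (1ℚ + (1ℚ + t) * p) ≡ x * (1ℚ + t * p) - x * ((1ℚ + t) * (p * p))
    eq = solve 3 (λ p x t → (con 1ℚ :- p) :* x :* (con 1ℚ :+ (con 1ℚ :+ t) :* p)
      := x :* (con 1ℚ :+ t :* p) :- x :* ((con 1ℚ :+ t) :* (p :* p))) refl

-- The random walk and its subharmonic lower bound

module Walks where

  open import Defs
  open Rationals
  open Probability
  open import Data.Bool.Base using (true; false)
  open import Data.Fin.Base using (Fin; zero; suc)
  import Data.Fin.Properties as Fin
  open import Data.List.Base as List using (List; []; _∷_; length)
  open import Data.List.Properties using (length-deduplicate; length-map)
  open import Data.List.Membership.Propositional using (_∈_; find)
  open import Data.List.Membership.Propositional.Properties using (∈-map⁺; ∈-deduplicate⁺)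
  open import Data.List.Relation.Unary.All as All using (All; []; _∷_)
  open import Data.List.Relation.Unary.Any using (here; there)
  open import Data.Maybe.Base using (just)
  open import Data.Nat.Base using (ℕ; zero; suc; NonZero; z≤n; s≤s)
  import Data.Nat.Base as ℕ
  import Data.Nat.Properties as ℕ
  open import Data.Nat.Tactic.RingSolver using (solve-∀)
  open import Data.Product.Base using (∃; _×_; _,_; proj₁)
  open import Data.Rational.Base using (ℚ; 1ℚ; _+_; _*_; _≤_)
  open import Data.Rational.Properties hiding (_≟_)
  open import Data.Rational.Solver using (module +-*-Solver)
  open import Data.Sum.Base using (inj₁; inj₂)
  open import Data.Vec.Base as Vec using (Vec; lookup)
  open import Function.Base using (_∘_)
  open import Relation.Binary.PropositionalEquality
  open import Relation.Nullary.Decidable using (yes; no)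
  open import Relation.Nullary.Negation using (¬_; contradiction)

  private
    variable
      n : ℕ

  dH-flip-≤ : (y z : Assignment n) (v : Fin n) → dH (flip y v) z ℕ.≤ suc (dH y z)
  dH-flip-≤ (false Vec.∷ y) (false Vec.∷ z) zero    = ℕ.≤-refl
  dH-flip-≤ (false Vec.∷ y) (true  Vec.∷ z) zero    = ℕ.m≤n⇒m≤1+n (ℕ.n≤1+n _)
  dH-flip-≤ (true  Vec.∷ y) (false Vec.∷ z) zero    = ℕ.m≤n⇒m≤1+n (ℕ.n≤1+n _)
  dH-flip-≤ (true  Vec.∷ y) (true  Vec.∷ z) zero    = ℕ.≤-refl
  dH-flip-≤ (false Vec.∷ y) (false Vec.∷ z) (suc v) = dH-flip-≤ y z v
  dH-flip-≤ (false Vec.∷ y) (true  Vec.∷ z) (suc v) = s≤s (dH-flip-≤ y z v)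
  dH-flip-≤ (true  Vec.∷ y) (false Vec.∷ z) (suc v) = s≤s (dH-flip-≤ y z v)
  dH-flip-≤ (true  Vec.∷ y) (true  Vec.∷ z) (suc v) = dH-flip-≤ y z v

  dH-flip-≢ : (y z : Assignment n) (v : Fin n) → lookup y v ≢ lookup z v →
    dH y z ≡ suc (dH (flip y v) z)
  dH-flip-≢ (false Vec.∷ y) (false Vec.∷ z) zero    d = contradiction refl d
  dH-flip-≢ (false Vec.∷ y) (true  Vec.∷ z) zero    d = refl
  dH-flip-≢ (true  Vec.∷ y) (false Vec.∷ z) zero    d = refl
  dH-flip-≢ (true  Vec.∷ y) (true  Vec.∷ z) zero    d = contradiction refl d
  dH-flip-≢ (false Vec.∷ y) (false Vec.∷ z) (suc v) d = dH-flip-≢ y z v d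
  dH-flip-≢ (false Vec.∷ y) (true  Vec.∷ z) (suc v) d = cong suc (dH-flip-≢ y z v d)
  dH-flip-≢ (true  Vec.∷ y) (false Vec.∷ z) (suc v) d = cong suc (dH-flip-≢ y z v d)
  dH-flip-≢ (true  Vec.∷ y) (true  Vec.∷ z) (suc v) d = dH-flip-≢ y z v d

  firstUnsatisfied-just : (F : CNF n) (y : Assignment n) → ¬ y ⊨ F →
    ∃ λ C → firstUnsatisfied F y ≡ just C × C ∈ F × ¬ y ⊨ᶜ C
  firstUnsatisfied-just []      y ¬y⊨F = contradiction [] ¬y⊨F
  firstUnsatisfied-just (C ∷ F) y ¬y⊨F with y ⊨ᶜ? C
  ... | no  ¬y⊨C = C , refl , here refl , ¬y⊨C
  ... | yes y⊨C with C′ , eq , C′∈F , ¬y⊨C′ ← firstUnsatisfied-just F y (¬y⊨F ∘ (y⊨C ∷_)) =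
    C′ , eq , there C′∈F , ¬y⊨C′

  -- A literal of `C` that `z` makes true is false under `y`, so the two assignments differ at its
  -- variable.
  disagreement : (C : Clause n) {y z : Assignment n} → ¬ y ⊨ᶜ C → z ⊨ᶜ C →
    ∃ λ v → v ∈ variables C × lookup y v ≢ lookup z v
  disagreement C ¬y⊨C z⊨C with (v , b) , v∈C , z≡b ← find z⊨C =
    v , ∈-deduplicate⁺ Fin._≟_ (∈-map⁺ proj₁ v∈C) ,
    λ y≡z → ¬y⊨C (Data.List.Membership.Propositional.lose v∈C (trans y≡z z≡b))

  length-variables : (C : Clause n) → length (variables C) ℕ.≤ length C
  length-variables C = ℕ.≤-trans (length-deduplicate Fin._≟_ (List.map proj₁ C))
    (ℕ.≤-reflexive (length-map proj₁ C))

  module _ {A : Set} {f : A → ℚ} {b : ℕ} where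

    total-≥ : ∀ xs → (∀ x → ι b ≤ f x) → ι (length xs ℕ.* b) ≤ total f xs
    total-≥ []       b≤f = ≤-reflexive ι-zero
    total-≥ (x ∷ xs) b≤f = subst (_≤ total f (x ∷ xs)) (sym (ι-+ b (length xs ℕ.* b)))
      (+-mono-≤ (b≤f x) (total-≥ xs b≤f))

    -- Meant for the variables of a violated clause: one flip is known to approach the target and
    -- gets the bound `a`, the others get the worst-case bound `b`.
    total-≥-special : ∀ {a x} y ys → x ∈ y ∷ ys → ι a ≤ f x → (∀ x → ι b ≤ f x) →
      ι (a ℕ.+ length ys ℕ.* b) ≤ total f (y ∷ ys)
    total-≥-special {a} y ys (here refl) a≤ b≤f = subst (_≤ total f (y ∷ ys))
      (sym (ι-+ a (length ys ℕ.* b))) (+-mono-≤ a≤ (total-≥ ys b≤f))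
    total-≥-special {a} y (y′ ∷ ys) (there x∈) a≤ b≤f = subst (_≤ total f (y ∷ y′ ∷ ys))
      (trans (sym (ι-+ b _)) (cong ι (eq a b (length ys ℕ.* b))))
      (+-mono-≤ (b≤f y) (total-≥-special {a} y′ ys x∈ a≤ b≤f))
      where
      eq : ∀ a b c → b ℕ.+ (a ℕ.+ c) ≡ a ℕ.+ (b ℕ.+ c)
      eq = solve-∀

  total-* : ∀ {A : Set} c (f : A → ℚ) xs → total (λ x → c * f x) xs ≡ c * total f xs
  total-* c f []       = sym (*-zeroʳ c)
  total-* c f (x ∷ xs) = trans (cong (c * f x +_) (total-* c f xs)) (sym (*-distribˡ-+ c (f x) _))

  -- Each additional variable adds `K * s` on the left but only `s ∸ 4` on the right, so j = K is
  -- the worst case. That case is `worst`, with the K copies of `b` cancelled.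
  step-arith : ∀ {K j} → 2 ℕ.≤ K → j ℕ.≤ K → ∀ s →
    suc j ℕ.* K ℕ.* s ℕ.≤ K ℕ.* K ℕ.* (2 ℕ.+ s) ℕ.+ j ℕ.* (s ℕ.∸ 4)
  step-arith {K} {j} 2≤K j≤K s = begin
    suc j ℕ.* K ℕ.* s                                    ≡⟨ ℕ.*-assoc (suc j) K s ⟩
    suc j ℕ.* (K ℕ.* s)                                  ≡⟨ cong (suc j ℕ.*_) Ks≡ ⟨
    suc j ℕ.* (b ℕ.+ x)                                  ≡⟨ eq₁ j b x ⟩
    suc j ℕ.* x ℕ.+ b ℕ.+ j ℕ.* b
      ≤⟨ ℕ.+-monoˡ-≤ (j ℕ.* b) (ℕ.+-monoˡ-≤ b (ℕ.*-monoˡ-≤ x (s≤s j≤K))) ⟩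
    suc K ℕ.* x ℕ.+ b ℕ.+ j ℕ.* b                        ≤⟨ ℕ.+-monoˡ-≤ (j ℕ.* b) worst ⟩
    K ℕ.* K ℕ.* (2 ℕ.+ s) ℕ.+ j ℕ.* b                    ∎
    where
    open ℕ.≤-Reasoning
    b = s ℕ.∸ 4
    x = K ℕ.* s ℕ.∸ b
    Ks≡ : b ℕ.+ x ≡ K ℕ.* s
    Ks≡ = ℕ.m+[n∸m]≡n (ℕ.≤-trans (ℕ.m∸n≤m s 4) (ℕ.m≤n*m s K {{ℕ.>-nonZero (ℕ.<-≤-trans (s≤s z≤n) 2≤K)}}))
    eq₁ : ∀ j b x → suc j ℕ.* (b ℕ.+ x) ≡ suc j ℕ.* x ℕ.+ b ℕ.+ j ℕ.* b
    eq₁ = solve-∀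
    eq₂ : ∀ K b x → suc K ℕ.* x ℕ.+ b ℕ.+ K ℕ.* b ≡ suc K ℕ.* (b ℕ.+ x)
    eq₂ = solve-∀
    eq₃ : ∀ K s → suc K ℕ.* (K ℕ.* s) ≡ K ℕ.* (K ℕ.* s) ℕ.+ K ℕ.* s
    eq₃ = solve-∀
    eq₄ : ∀ K s b → K ℕ.* (K ℕ.* s) ℕ.+ K ℕ.* (2 ℕ.* K ℕ.+ b) ≡ K ℕ.* K ℕ.* (2 ℕ.+ s) ℕ.+ K ℕ.* b
    eq₄ = solve-∀
    -- The factor 3 in t - 3d and k ≥ 3 meet here: the loss 4 at the far neighbour is at most 2K,
    -- the gain 2 at the near one weighted by K.
    s≤ : s ℕ.≤ 2 ℕ.* K ℕ.+ b
    s≤ = ℕ.≤-trans (ℕ.m≤n+m∸n s 4) (ℕ.+-monoˡ-≤ b (ℕ.*-monoʳ-≤ 2 2≤K))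
    worst : suc K ℕ.* x ℕ.+ b ℕ.≤ K ℕ.* K ℕ.* (2 ℕ.+ s)
    worst = ℕ.+-cancelʳ-≤ (K ℕ.* b) _ _ (begin
      suc K ℕ.* x ℕ.+ b ℕ.+ K ℕ.* b                      ≡⟨ eq₂ K b x ⟩
      suc K ℕ.* (b ℕ.+ x)                                ≡⟨ cong (suc K ℕ.*_) Ks≡ ⟩
      suc K ℕ.* (K ℕ.* s)                                ≡⟨ eq₃ K s ⟩
      K ℕ.* (K ℕ.* s) ℕ.+ K ℕ.* s
        ≤⟨ ℕ.+-monoʳ-≤ (K ℕ.* (K ℕ.* s)) (ℕ.*-monoʳ-≤ K s≤) ⟩
      K ℕ.* (K ℕ.* s) ℕ.+ K ℕ.* (2 ℕ.* K ℕ.+ b)          ≡⟨ eq₄ K s b ⟩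
      K ℕ.* K ℕ.* (2 ℕ.+ s) ℕ.+ K ℕ.* b                  ∎)

  -- K ^ (d + 2) times the subharmonicity at distance d + 1, for a clause with suc j ≤ K + 1 variables
  -- of which one leads to distance d.
  potential-step : ∀ {K j} → 2 ℕ.≤ K → j ℕ.≤ K → ∀ t d →
    suc j ℕ.* K ℕ.* (suc t ℕ.∸ 3 ℕ.* suc d) ℕ.≤
    K ℕ.* K ℕ.* (t ℕ.∸ 3 ℕ.* d) ℕ.+ j ℕ.* (t ℕ.∸ 3 ℕ.* suc (suc d))
  potential-step {K} {j} 2≤K j≤K t d with ℕ.≤-total (suc t) (3 ℕ.* suc d)
  -- Where the left side truncates there is nothing to show. Otherwise the near neighbour has the
  -- exact value 2 + s, and only the far one, `s ∸ 4`, can still truncate.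
  ... | inj₁ t<3[d+1] rewrite ℕ.m≤n⇒m∸n≡0 t<3[d+1] | ℕ.*-zeroʳ (suc j ℕ.* K) = z≤n
  ... | inj₂ 3[d+1]≤t = subst₂ (λ a b → suc j ℕ.* K ℕ.* s ℕ.≤ K ℕ.* K ℕ.* a ℕ.+ j ℕ.* b) (sym eq₁) (sym eq₂)
        (step-arith 2≤K j≤K s)
    where
    s = suc t ℕ.∸ 3 ℕ.* suc d
    t≡ : t ≡ 2 ℕ.+ s ℕ.+ 3 ℕ.* d
    t≡ = ℕ.suc-injective (trans (sym (ℕ.m∸n+n≡m 3[d+1]≤t)) (eq s d))
      where
      eq : ∀ s d → s ℕ.+ 3 ℕ.* suc d ≡ suc (2 ℕ.+ s ℕ.+ 3 ℕ.* d)
      eq = solve-∀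
    eq₁ : t ℕ.∸ 3 ℕ.* d ≡ 2 ℕ.+ s
    eq₁ = trans (cong (ℕ._∸ 3 ℕ.* d) t≡) (ℕ.m+n∸n≡m (2 ℕ.+ s) (3 ℕ.* d))
    eq₂ : t ℕ.∸ 3 ℕ.* suc (suc d) ≡ s ℕ.∸ 4
    eq₂ = trans (cong₂ ℕ._∸_ (trans t≡ (assoc s d)) (dist d)) (ℕ.[m+n]∸[m+o]≡n∸o (2 ℕ.+ 3 ℕ.* d) s 4)
      where
      assoc : ∀ s d → 2 ℕ.+ s ℕ.+ 3 ℕ.* d ≡ 2 ℕ.+ 3 ℕ.* d ℕ.+ s
      assoc = solve-∀
      dist : ∀ d → 3 ℕ.* suc (suc d) ≡ 2 ℕ.+ 3 ℕ.* d ℕ.+ 4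
      dist = solve-∀

  module _ {K : ℕ} (2≤K : 2 ℕ.≤ K) (F : CNF n) (F∈kCNF : Is suc K CNF F)
           {z : Assignment n} (z⊨F : z ⊨ F) (L : ℕ) where

    private
      instance
        K-nonZero : NonZero K
        K-nonZero = ℕ.>-nonZero (ℕ.<-≤-trans (s≤s z≤n) 2≤K)

    scale : ℕ → ℕ
    scale d = L ℕ.* K ℕ.^ d

    scale-mono : ∀ {d e} → d ℕ.≤ e → scale d ℕ.≤ scale e
    scale-mono d≤e = ℕ.*-monoʳ-≤ L (ℕ.^-monoʳ-≤ K d≤e)

    -- `L` normalises the potential and becomes 3n. The walk may stop at a satisfying assignment
    -- other than `z`; success is then certain, and `t ≤ L` makes the bound hold at any distance
    -- from `z`. With t = 0 the walk returns `nothing`, matching the truncated left side.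
    walk-bound : ∀ t → t ℕ.≤ L → ∀ y →
      ι (t ℕ.∸ 3 ℕ.* dH y z) ≤ ι (scale (dH y z)) * success F (walk F t y)

    -- Only the flip of `v` is known to approach `z`. Any other flip, also one that happens to
    -- approach `z`, is estimated as if it moved away, which is allowed because the bound on success
    -- weakens with distance. Here `d` is the distance after flipping `v`, so `y` is at `suc d` and
    -- the worst neighbour at `suc (suc d)`.
    flip-bound : ∀ t y → (∀ y → ι (t ℕ.∸ 3 ℕ.* dH y z) ≤ ι (scale (dH y z)) * success F (walk F t y)) →
      ∀ C → length C ℕ.≤ suc K → ∃ (λ v → v ∈ variables C × lookup y v ≢ lookup z v) →
      ι (suc t ℕ.∸ 3 ℕ.* dH y z) ≤ ι (scale (dH y z)) * success F (fix (just C) y >>= walk F t)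
    flip-bound t y ih C |C|≤k (v , v∈ , y≢z) with variables C | length-variables C
    ... | w ∷ ws | |vs|≤|C| rewrite dH-flip-≢ y z v y≢z =
      -- The factor `suc j` clears the uniform choice among the variables, and `K` raises the scale
      -- to that of the farthest neighbour, common to all terms.
      ι-*-cancel-≤ (suc j ℕ.* K) {{ℕ.m*n≢0 (suc j) K}} (begin
        ι (suc j ℕ.* K) * ι s
          ≡⟨ ι-* (suc j ℕ.* K) s ⟨
        ι (suc j ℕ.* K ℕ.* s)
          ≤⟨ ι-mono-≤ (potential-step 2≤K j≤K t d) ⟩
        ι (K ℕ.* K ℕ.* (t ℕ.∸ 3 ℕ.* d) ℕ.+ j ℕ.* (t ℕ.∸ 3 ℕ.* suc (suc d)))
          ≤⟨ total-≥-special {f = λ x → ι (scale (suc (suc d))) * H x} {b = t ℕ.∸ 3 ℕ.* suc (suc d)}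
              {a = K ℕ.* K ℕ.* (t ℕ.∸ 3 ℕ.* d)} w ws v∈ special generic ⟩
        total (λ x → ι (scale (suc (suc d))) * H x) (w ∷ ws)
          ≡⟨ total-* (ι (scale (suc (suc d)))) H (w ∷ ws) ⟩
        ι (scale (suc (suc d))) * total H (w ∷ ws)
          ≡⟨ cong₂ _*_ (trans (cong ι (eq₁ L K (K ℕ.^ d))) (ι-* K (scale (suc d))))
              (sym (Pr-uniform (succeeds? F) w ws (λ x → walk F t (flip y x)))) ⟩
        ι K * ι (scale (suc d)) * (ι (suc j) * p)
          ≡⟨ eq₂ (ι K) (ι (scale (suc d))) (ι (suc j)) p ⟩
        ι (suc j) * ι K * (ι (scale (suc d)) * p)
          ≡⟨ cong (_* (ι (scale (suc d)) * p)) (ι-* (suc j) K) ⟨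
        ι (suc j ℕ.* K) * (ι (scale (suc d)) * p) ∎)
      where
      open ≤-Reasoning
      j = length ws
      d = dH (flip y v) z
      s = suc t ℕ.∸ 3 ℕ.* suc d
      H : Fin n → ℚ
      H x = success F (walk F t (flip y x))
      p = success F (flipOneOf (w ∷ ws) y >>= walk F t)
      j≤K : j ℕ.≤ K
      j≤K = ℕ.≤-pred (ℕ.≤-trans |vs|≤|C| |C|≤k)
      eq₁ : ∀ L K x → L ℕ.* (K ℕ.* (K ℕ.* x)) ≡ K ℕ.* (L ℕ.* (K ℕ.* x))
      eq₁ = solve-∀
      eq₂ : ∀ a b c e → a * b * (c * e) ≡ c * a * (b * e)
      eq₂ = solve 4 (λ a b c e → a :* b :* (c :* e) := c :* a :* (b :* e)) refl
        where open +-*-Solver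
      special : ι (K ℕ.* K ℕ.* (t ℕ.∸ 3 ℕ.* d)) ≤ ι (scale (suc (suc d))) * H v
      special = begin
        ι (K ℕ.* K ℕ.* (t ℕ.∸ 3 ℕ.* d))          ≡⟨ ι-* (K ℕ.* K) (t ℕ.∸ 3 ℕ.* d) ⟩
        ι (K ℕ.* K) * ι (t ℕ.∸ 3 ℕ.* d)      ≤⟨ *-monoˡ-≤ (0≤ι (K ℕ.* K)) (ih (flip y v)) ⟩
        ι (K ℕ.* K) * (ι (scale d) * H v)    ≡⟨ *-assoc (ι (K ℕ.* K)) (ι (scale d)) (H v) ⟨
        ι (K ℕ.* K) * ι (scale d) * H v      ≡⟨ cong (_* H v) (ι-* (K ℕ.* K) (scale d)) ⟨
        ι (K ℕ.* K ℕ.* scale d) * H v            ≡⟨ cong (λ e → ι e * H v) (eq₃ L K (K ℕ.^ d)) ⟩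
        ι (scale (suc (suc d))) * H v            ∎
        where
        eq₃ : ∀ L K x → K ℕ.* K ℕ.* (L ℕ.* x) ≡ L ℕ.* (K ℕ.* (K ℕ.* x))
        eq₃ = solve-∀
      generic : ∀ x → ι (t ℕ.∸ 3 ℕ.* suc (suc d)) ≤ ι (scale (suc (suc d))) * H x
      generic x = begin
        ι (t ℕ.∸ 3 ℕ.* suc (suc d))              ≤⟨ ι-mono-≤ (ℕ.∸-monoʳ-≤ t (ℕ.*-monoʳ-≤ 3 far)) ⟩
        ι (t ℕ.∸ 3 ℕ.* dH (flip y x) z)          ≤⟨ ih (flip y x) ⟩
        ι (scale (dH (flip y x) z)) * H x
          ≤⟨ *-monoʳ-≤ (0≤Pr (succeeds? F) (walk F t (flip y x))) (ι-mono-≤ (scale-mono far)) ⟩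
        ι (scale (suc (suc d))) * H x            ∎
        where
        far : dH (flip y x) z ℕ.≤ suc (suc d)
        far = ℕ.≤-trans (dH-flip-≤ y z x) (s≤s (ℕ.≤-reflexive (dH-flip-≢ y z v y≢z)))

    walk-bound zero    _   y = ≤-reflexive (trans (trans (cong ι (ℕ.0∸n≡0 (3 ℕ.* dH y z))) ι-zero)
      (sym (*-zeroʳ (ι (scale (dH y z))))))
    walk-bound (suc t) t<L y with y ⊨? F
    ... | yes y⊨F = begin
      ι (suc t ℕ.∸ 3 ℕ.* dH y z)
        ≤⟨ ι-mono-≤ (ℕ.≤-trans (ℕ.m∸n≤m (suc t) (3 ℕ.* dH y z))
            (ℕ.≤-trans t<L (ℕ.m≤m*n L (K ℕ.^ dH y z) {{ℕ.m^n≢0 K (dH y z)}}))) ⟩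
      ι (scale (dH y z))               ≡⟨ *-identityʳ _ ⟨
      ι (scale (dH y z)) * 1ℚ          ≡⟨ cong (ι (scale (dH y z)) *_) (success-sat F y⊨F) ⟨
      ι (scale (dH y z)) * success F (return (just y)) ∎
      where open ≤-Reasoning
    ... | no ¬y⊨F with C , eq , C∈F , ¬y⊨C ← firstUnsatisfied-just F y ¬y⊨F rewrite eq =
      flip-bound t y (walk-bound t (ℕ.<⇒≤ t<L)) C (All.lookup F∈kCNF C∈F)
        (disagreement C {y} {z} ¬y⊨C (All.lookup z⊨F C∈F))

-- Success of one iteration, the number of trials, and the bound

module Iterations where

  open import Defs
  open Rationals
  open Weights
  open Packings
  open Probability
  open Walks
  open import Data.Nat.Combinatorics using (_C_)
  open import Data.Nat.ListAction using (sum)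
  open import Data.Nat.DivMod using (m/n*n≤m)
  import Data.Integer.Base as ℤ
  import Data.Integer.Properties as ℤ
  open import Data.List.Base as List using ([]; _∷_; length; map; filter)
  open import Data.List.Membership.Propositional using (_∈_)
  open import Data.List.Membership.Propositional.Properties using (∈-filter⁻)
  open import Data.List.Relation.Unary.Any using (here)
  import Data.List.NonEmpty.Base as List⁺
  open import Data.Nat.Base using (ℕ; zero; suc; pred; NonZero; z≤n; s≤s)
  import Data.Nat.Base as ℕ
  import Data.Nat.Properties as ℕ
  open import Data.Nat.Tactic.RingSolver using (solve-∀)
  open import Data.Product.Base using (_,_)
  open import Data.Rational.Base using (ℚ; 0ℚ; 1ℚ; mkℚ; _+_; _*_; _-_; -_; _/_; _≤_; _<_; ↧ₙ_; positive)
  open import Data.Rational.Properties hiding (_≟_)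
  open import Data.Rational.Solver using (module +-*-Solver)
  import Data.Rational.Unnormalised.Base as ℚᵘ
  import Data.Rational.Unnormalised.Properties as ℚᵘ
  open import Relation.Binary.PropositionalEquality

  private
    variable
      n : ℕ

  total-mono-ℕ : ∀ {A : Set} {f : A → ℕ} {c} {g : A → ℚ} → (∀ x → ι (f x) ≤ c * g x) →
    ∀ xs → ι (sum (map f xs)) ≤ c * total g xs
  total-mono-ℕ {c = c} h [] = ≤-reflexive (trans ι-zero (sym (*-zeroʳ c)))
  total-mono-ℕ {f = f} {c} {g} h (x ∷ xs) = begin
    ι (f x ℕ.+ sum (map f xs))          ≡⟨ ι-+ (f x) (sum (map f xs)) ⟩
    ι (f x) + ι (sum (map f xs))        ≤⟨ +-mono-≤ (h x) (total-mono-ℕ {f = f} {c} {g} h xs) ⟩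
    c * g x + c * total g xs            ≡⟨ *-distribˡ-+ c (g x) (total g xs) ⟨
    c * (g x + total g xs)              ∎
    where open ≤-Reasoning

  ^-distrib-* : ∀ p q n → (p * q) ^ n ≡ p ^ n * q ^ n
  ^-distrib-* p q zero    = sym (*-identityˡ 1ℚ)
  ^-distrib-* p q (suc n) = trans (cong (p * q *_) (^-distrib-* p q n)) (eq p q (p ^ n) (q ^ n))
    where
    open +-*-Solver
    eq : ∀ p q x y → p * q * (x * y) ≡ p * x * (q * y)
    eq = solve 4 (λ p q x y → p :* q :* (x :* y) := p :* x :* (q :* y)) refl

  module _ {K : ℕ} (2≤K : 2 ℕ.≤ K) where

    private
      instance
        K-nonZero : NonZero K
        K-nonZero = ℕ.>-nonZero (ℕ.<-≤-trans (s≤s z≤n) 2≤K)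

    module _ (F : CNF n) where

      r ρ w : ℕ
      r = (2 ℕ.* n) ℕ./ suc K
      ρ = radius r
      w = weight K n ρ

      -- The bound of the theorem is volume / density.
      density volume trials : ℕ
      density = suc K ℕ.^ n ℕ.* N F r
      volume  = 2 ℕ.^ n ℕ.* K ℕ.^ n
      -- suc (pred density) is density whenever F is satisfiable.
      trials  = suc ((3 ℕ.* suc n ℕ.^ 3 ℕ.* volume) ℕ./ suc (pred density))

      density≤ : density ℕ.≤ suc n ℕ.^ 2 ℕ.* (w ℕ.* N F r)
      density≤ = ℕ.≤-trans
        (ℕ.*-monoˡ-≤ (N F r) (^≤weight K n (radius-upper n (suc K)) (radius-lower n (suc K))))
        (ℕ.≤-reflexive (eq (suc n) w (N F r)))
        where
        eq : ∀ a b c → a ℕ.* (a ℕ.* b) ℕ.* c ≡ a ℕ.* (a ℕ.* 1) ℕ.* (b ℕ.* c)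
        eq = solve-∀

      -- Exchanges the term of the expansion, which is comparable with k^n, for the binomial
      -- coefficient, which counts a sphere.
      weight-transfer : w ℕ.* N F r ℕ.* K ℕ.^ ρ ≡ N F r ℕ.* (n C ρ) ℕ.* K ℕ.^ n
      weight-transfer = trans (eq w (N F r) (K ℕ.^ ρ))
        (trans (cong (N F r ℕ.*_) (sym (C*^≡weight*^ K n ρ))) (sym (ℕ.*-assoc (N F r) (n C ρ) (K ℕ.^ n))))
        where
        eq : ∀ a b c → a ℕ.* b ℕ.* c ≡ b ℕ.* (a ℕ.* c)
        eq = solve-∀

      -- From ρk ≤ n and k ≥ 3. A start at distance ρ thus keeps 3n - 3ρ ≥ n, at least a third of
      -- the normalisation 3n.
      3ρ≤n : 3 ℕ.* ρ ℕ.≤ n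
      3ρ≤n = ℕ.≤-trans (ℕ.≤-reflexive (ℕ.*-comm 3 ρ))
        (ℕ.≤-trans (ℕ.*-monoʳ-≤ ρ (s≤s 2≤K)) (radius-upper n (suc K)))

      -- For satisfiable `F` it says that the bound of the theorem is at least 1/(n+1)², so rounding
      -- the number of trials up costs only a polynomial factor.
      density≤volume : density ℕ.≤ suc n ℕ.^ 2 ℕ.* volume
      density≤volume with S , packing , |S|≡N ← max-packing F r = begin
        density                                            ≤⟨ density≤ ⟩
        suc n ℕ.^ 2 ℕ.* (w ℕ.* N F r)                      ≤⟨ ℕ.*-monoʳ-≤ (suc n ℕ.^ 2) (begin
          w ℕ.* N F r
            ≤⟨ ℕ.m≤m*n (w ℕ.* N F r) (K ℕ.^ ρ) {{ℕ.m^n≢0 K ρ}} ⟩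
          w ℕ.* N F r ℕ.* K ℕ.^ ρ                            ≡⟨ weight-transfer ⟩
          N F r ℕ.* (n C ρ) ℕ.* K ℕ.^ n
            ≡⟨ cong (λ e → e ℕ.* (n C ρ) ℕ.* K ℕ.^ n) |S|≡N ⟨
          length S ℕ.* (n C ρ) ℕ.* K ℕ.^ n
            ≤⟨ ℕ.*-monoˡ-≤ (K ℕ.^ n) (packing-bound packing) ⟩
          volume                                             ∎) ⟩
        suc n ℕ.^ 2 ℕ.* volume                             ∎
        where open ℕ.≤-Reasoning

      p : ℚ
      p = success F (iteration F)

      module _ .{{n≢0 : NonZero n}} (F∈kCNF : Is suc K CNF F) where

        -- Disjointness makes `nearby` an indicator, and the centre it detects is the target for
        -- `walk-bound`. The factor n of the normalisation 3n is cancelled, whence n > 0; for n = 0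
        -- the walk has no rounds and never succeeds.
        nearby-success : ∀ {S} → IsPacking F r S → ∀ y →
          ι (nearby S ρ y) ≤ ι (3 ℕ.* K ℕ.^ ρ) * success F (walk F (3 ℕ.* n) y)
        nearby-success {S} packing y with filter (λ z → dH y z ℕ.≟ ρ) S in eq | nearby≤1 packing y
        ... | []     | _   = subst (_≤ ι (3 ℕ.* K ℕ.^ ρ) * success F (walk F (3 ℕ.* n) y)) (sym ι-zero)
          (0≤* (0≤ι (3 ℕ.* K ℕ.^ ρ)) (0≤Pr (succeeds? F) (walk F (3 ℕ.* n) y)))
        ... | z ∷ zs | ≤1
          with z∈S , dH≡ρ ← ∈-filter⁻ (λ z → dH y z ℕ.≟ ρ) {xs = S} (subst (z ∈_) (sym eq) (here refl)) =
          ι-*-cancel-≤ n (begin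
            ι n * ι (suc (length zs))                ≡⟨ ι-* n (suc (length zs)) ⟨
            ι (n ℕ.* suc (length zs))                ≤⟨ ι-mono-≤ enough ⟩
            ι (3 ℕ.* n ℕ.∸ 3 ℕ.* dH y z)
              ≤⟨ walk-bound 2≤K F F∈kCNF (satisfies z∈S) (3 ℕ.* n) (3 ℕ.* n) ℕ.≤-refl y ⟩
            ι (3 ℕ.* n ℕ.* K ℕ.^ dH y z) * s
              ≡⟨ cong (λ d → ι (3 ℕ.* n ℕ.* K ℕ.^ d) * s) dH≡ρ ⟩
            ι (3 ℕ.* n ℕ.* K ℕ.^ ρ) * s
              ≡⟨ cong (_* s) (trans (cong ι (eq′ n (K ℕ.^ ρ))) (ι-* n (3 ℕ.* K ℕ.^ ρ))) ⟩
            ι n * ι (3 ℕ.* K ℕ.^ ρ) * s              ≡⟨ *-assoc (ι n) (ι (3 ℕ.* K ℕ.^ ρ)) s ⟩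
            ι n * (ι (3 ℕ.* K ℕ.^ ρ) * s)            ∎)
          where
          open ≤-Reasoning
          open IsPacking packing
          s = success F (walk F (3 ℕ.* n) y)
          eq′ : ∀ n x → 3 ℕ.* n ℕ.* x ≡ n ℕ.* (3 ℕ.* x)
          eq′ = solve-∀
          enough : n ℕ.* suc (length zs) ℕ.≤ 3 ℕ.* n ℕ.∸ 3 ℕ.* dH y z
          enough = ℕ.≤-trans (ℕ.≤-trans (ℕ.*-monoʳ-≤ n ≤1) (ℕ.≤-reflexive (ℕ.*-identityʳ n)))
            (ℕ.m+n≤o⇒m≤o∸n n (subst (λ d → n ℕ.+ 3 ℕ.* d ℕ.≤ 3 ℕ.* n) (sym dH≡ρ)
              (ℕ.+-monoʳ-≤ n (ℕ.≤-trans 3ρ≤n (ℕ.m≤m+n n (1 ℕ.* n))))))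

        N*C≤ : ι (N F r ℕ.* (n C ρ)) ≤ ι (3 ℕ.* K ℕ.^ ρ) * (ι (2 ℕ.^ n) * p)
        N*C≤ with S , packing , |S|≡N ← max-packing F r = begin
          ι (N F r ℕ.* (n C ρ))                         ≡⟨ cong (λ e → ι (e ℕ.* (n C ρ))) |S|≡N ⟨
          ι (length S ℕ.* (n C ρ))                      ≡⟨ cong ι (nearby-sum S ρ) ⟨
          ι (sum (map (nearby S ρ) (points n)))
            ≤⟨ total-mono-ℕ {c = c} {s} (nearby-success packing) (points n) ⟩
          c * total s (points n)
            ≡⟨ cong (c *_) (Pr-uniform (succeeds? F)
              (List⁺.head (cube n)) (List⁺.tail (cube n)) (walk F (3 ℕ.* n))) ⟨
          c * (ι (length (points n)) * p)
            ≡⟨ cong (λ e → c * (ι e * p)) (length-cube n) ⟩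
          c * (ι (2 ℕ.^ n) * p)                         ∎
          where
          open ≤-Reasoning
          c = ι (3 ℕ.* K ℕ.^ ρ)
          s : Assignment n → ℚ
          s y = success F (walk F (3 ℕ.* n) y)

        weight*N≤ : ι (w ℕ.* N F r) ≤ ι (3 ℕ.* volume) * p
        weight*N≤ = ι-*-cancel-≤ (K ℕ.^ ρ) {{ℕ.m^n≢0 K ρ}} (begin
          ι x * ι (w ℕ.* N F r)                          ≡⟨ ι-* x (w ℕ.* N F r) ⟨
          ι (x ℕ.* (w ℕ.* N F r))
            ≡⟨ cong ι (trans (ℕ.*-comm x (w ℕ.* N F r)) (trans weight-transfer
              (ℕ.*-comm (N F r ℕ.* (n C ρ)) (K ℕ.^ n)))) ⟩
          ι (K ℕ.^ n ℕ.* (N F r ℕ.* (n C ρ)))            ≡⟨ ι-* (K ℕ.^ n) (N F r ℕ.* (n C ρ)) ⟩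
          ι (K ℕ.^ n) * ι (N F r ℕ.* (n C ρ))            ≤⟨ *-monoˡ-≤ (0≤ι (K ℕ.^ n)) N*C≤ ⟩
          ι (K ℕ.^ n) * (ι (3 ℕ.* x) * (ι (2 ℕ.^ n) * p))
            ≡⟨ eq₁ (ι (K ℕ.^ n)) (ι (3 ℕ.* x)) (ι (2 ℕ.^ n)) p ⟩
          ι (K ℕ.^ n) * ι (3 ℕ.* x) * ι (2 ℕ.^ n) * p
            ≡⟨ cong (_* p) (trans (ι-* (K ℕ.^ n ℕ.* (3 ℕ.* x)) (2 ℕ.^ n))
              (cong (_* ι (2 ℕ.^ n)) (ι-* (K ℕ.^ n) (3 ℕ.* x)))) ⟨
          ι (K ℕ.^ n ℕ.* (3 ℕ.* x) ℕ.* 2 ℕ.^ n) * p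
            ≡⟨ cong (λ e → ι e * p) (eq₂ (K ℕ.^ n) x (2 ℕ.^ n)) ⟩
          ι (x ℕ.* (3 ℕ.* volume)) * p                   ≡⟨ cong (_* p) (ι-* x (3 ℕ.* volume)) ⟩
          ι x * ι (3 ℕ.* volume) * p                     ≡⟨ *-assoc (ι x) (ι (3 ℕ.* volume)) p ⟩
          ι x * (ι (3 ℕ.* volume) * p)                   ∎)
          where
          open ≤-Reasoning
          x = K ℕ.^ ρ
          eq₁ : ∀ a b c d → a * (b * (c * d)) ≡ a * b * c * d
          eq₁ = solve 4 (λ a b c d → a :* (b :* (c :* d)) := a :* b :* c :* d) refl
            where open +-*-Solver
          eq₂ : ∀ a x b → a ℕ.* (3 ℕ.* x) ℕ.* b ≡ x ℕ.* (3 ℕ.* (b ℕ.* a))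
          eq₂ = solve-∀

        density≤success : ι density ≤ ι (suc n ℕ.^ 2 ℕ.* (3 ℕ.* volume)) * p
        density≤success = begin
          ι density                                            ≤⟨ ι-mono-≤ density≤ ⟩
          ι (m ℕ.* (w ℕ.* N F r))                              ≡⟨ ι-* m (w ℕ.* N F r) ⟩
          ι m * ι (w ℕ.* N F r)                                ≤⟨ *-monoˡ-≤ (0≤ι m) weight*N≤ ⟩
          ι m * (ι (3 ℕ.* volume) * p)
            ≡⟨ *-assoc (ι m) (ι (3 ℕ.* volume)) p ⟨
          ι m * ι (3 ℕ.* volume) * p
            ≡⟨ cong (_* p) (ι-* m (3 ℕ.* volume)) ⟨
          ι (m ℕ.* (3 ℕ.* volume)) * p                         ∎
          where
          open ≤-Reasoning
          m = suc n ℕ.^ 2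

      module _ (sat : Satisfiable F) where

        private
          instance
            N≢0 : NonZero (N F r)
            N≢0 = N-nonZero F r sat
            density≢0 : NonZero density
            density≢0 = ℕ.m*n≢0 (suc K ℕ.^ n) (N F r) {{ℕ.m^n≢0 (suc K) n}}

        trials-lower : 3 ℕ.* suc n ℕ.^ 3 ℕ.* volume ℕ.≤ trials ℕ.* density
        trials-lower = subst (λ d → 3 ℕ.* suc n ℕ.^ 3 ℕ.* volume ℕ.≤ trials ℕ.* d) (ℕ.suc-pred density)
          (ℕ.<⇒≤ (m<[1+m/n]*n (3 ℕ.* suc n ℕ.^ 3 ℕ.* volume) (suc (pred density))))

        -- The trial added by rounding contributes `density`, which `density≤volume` absorbs into
        -- one more copy of (n+1)³ `volume`; hence 4 = 1 + 3.
        trials-upper : trials ℕ.* density ℕ.≤ 4 ℕ.* suc n ℕ.^ 3 ℕ.* volume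
        trials-upper = subst (λ d → trials ℕ.* d ℕ.≤ 4 ℕ.* suc n ℕ.^ 3 ℕ.* volume) (ℕ.suc-pred density) (begin
          d ℕ.+ X ℕ./ d ℕ.* d
            ≤⟨ ℕ.+-mono-≤ (ℕ.≤-trans (ℕ.≤-reflexive (ℕ.suc-pred density)) density≤volume) (m/n*n≤m X d) ⟩
          suc n ℕ.^ 2 ℕ.* volume ℕ.+ X
            ≤⟨ ℕ.+-monoˡ-≤ X (ℕ.*-monoˡ-≤ volume (ℕ.^-monoʳ-≤ (suc n) {2} {3} (ℕ.n≤1+n 2))) ⟩
          suc n ℕ.^ 3 ℕ.* volume ℕ.+ X                   ≡⟨ eq (suc n ℕ.^ 3) volume ⟩
          4 ℕ.* suc n ℕ.^ 3 ℕ.* volume                   ∎)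
          where
          open ℕ.≤-Reasoning
          d = suc (pred density)
          X = 3 ℕ.* suc n ℕ.^ 3 ℕ.* volume
          eq : ∀ a v → a ℕ.* v ℕ.+ 3 ℕ.* a ℕ.* v ≡ 4 ℕ.* a ℕ.* v
          eq = solve-∀

        -- Since k (1 - 1/k) = K, the factor k^n turns (1 - 1/k)^n into K^n, and `N F r` cancels its
        -- inverse.
        density*bound : ι density * bound (suc K) F sat ≡ ι volume
        density*bound = begin
          ι (suc K ℕ.^ n ℕ.* N F r) * (fromℕ 2 ^ n * x ^ n * (ℤ.+ 1 / N F r))
            ≡⟨ cong₂ (λ a b → a * (b ^ n * x ^ n * (ℤ.+ 1 / N F r)))
              (trans (ι-* (suc K ℕ.^ n) (N F r)) (cong (_* ι (N F r)) (ι-^ (suc K) n))) (sym (ι≡fromℕ 2)) ⟩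
          ι (suc K) ^ n * ι (N F r) * (ι 2 ^ n * x ^ n * (ℤ.+ 1 / N F r))
            ≡⟨ eq (ι (suc K) ^ n) (ι (N F r)) (ι 2 ^ n) (x ^ n) (ℤ.+ 1 / N F r) ⟩
          ι 2 ^ n * (ι (suc K) ^ n * x ^ n) * (ι (N F r) * (ℤ.+ 1 / N F r))
            ≡⟨ cong₂ (λ a b → ι 2 ^ n * a * b) (sym (^-distrib-* (ι (suc K)) x n)) (ι-*-inverse (N F r)) ⟩
          ι 2 ^ n * (ι (suc K) * x) ^ n * 1ℚ
            ≡⟨ *-identityʳ _ ⟩
          ι 2 ^ n * (ι (suc K) * x) ^ n
            ≡⟨ cong (λ e → ι 2 ^ n * e ^ n) k*x ⟩
          ι 2 ^ n * ι K ^ n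
            ≡⟨ cong₂ _*_ (ι-^ 2 n) (ι-^ K n) ⟨
          ι (2 ℕ.^ n) * ι (K ℕ.^ n)
            ≡⟨ ι-* (2 ℕ.^ n) (K ℕ.^ n) ⟨
          ι volume ∎
          where
          open ≡-Reasoning
          x = 1ℚ - ℤ.+ 1 / suc K
          eq : ∀ a b c d e → a * b * (c * d * e) ≡ c * (a * d) * (b * e)
          eq = solve 5 (λ a b c d e → a :* b :* (c :* d :* e) := c :* (a :* d) :* (b :* e)) refl
            where open +-*-Solver
          eq′ : ∀ a b → a * (1ℚ - b) ≡ a - a * b
          eq′ = solve 2 (λ a b → a :* (con 1ℚ :- b) := a :- a :* b) refl
            where open +-*-Solver
          eq″ : ∀ a → 1ℚ + a - 1ℚ ≡ a
          eq″ = solve 1 (λ a → con 1ℚ :+ a :- con 1ℚ := a) refl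
            where open +-*-Solver
          k*x : ι (suc K) * x ≡ ι K
          k*x = begin
            ι (suc K) * x                              ≡⟨ eq′ (ι (suc K)) (ℤ.+ 1 / suc K) ⟩
            ι (suc K) - ι (suc K) * (ℤ.+ 1 / suc K)
              ≡⟨ cong (λ e → ι (suc K) - e) (ι-*-inverse (suc K)) ⟩
            ι (suc K) - 1ℚ
              ≡⟨ cong (_- 1ℚ) (trans (ι-+ 1 K) (cong (_+ ι K) ι-one)) ⟩
            1ℚ + ι K - 1ℚ                              ≡⟨ eq″ (ι K) ⟩
            ι K                                        ∎

        trials≤bound : ι trials ≤ ι (4 ℕ.* suc n ℕ.^ 3) * bound (suc K) F sat
        trials≤bound = ι-*-cancel-≤ density (begin
          ι density * ι trials                         ≡⟨ ι-* density trials ⟨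
          ι (density ℕ.* trials)
            ≤⟨ ι-mono-≤ (ℕ.≤-trans (ℕ.≤-reflexive (ℕ.*-comm density trials)) trials-upper) ⟩
          ι (4 ℕ.* suc n ℕ.^ 3 ℕ.* volume)             ≡⟨ ι-* (4 ℕ.* suc n ℕ.^ 3) volume ⟩
          c * ι volume                                 ≡⟨ cong (c *_) density*bound ⟨
          c * (ι density * b)                          ≡⟨ eq c (ι density) b ⟩
          ι density * (c * b)                          ∎)
          where
          open ≤-Reasoning
          c = ι (4 ℕ.* suc n ℕ.^ 3)
          b = bound (suc K) F sat
          eq : ∀ a b c → a * (b * c) ≡ b * (a * c)
          eq = solve 3 (λ a b c → a :* (b :* c) := b :* (a :* c)) refl
            where open +-*-Solver

        -- Of the factor 3 (n+1)³ in `trials`, 3 (n+1)² makes up for the loss in the lower bound on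
        -- `p`; the last n + 1 drives the failure probability to 0.
        suc≤trials*p : .{{NonZero n}} → Is suc K CNF F → ι (suc n) ≤ ι trials * p
        suc≤trials*p F∈kCNF = ι-*-cancel-≤ X {{X≢0}} (begin
          ι X * ι (suc n)                              ≡⟨ ι-* X (suc n) ⟨
          ι (X ℕ.* suc n)
            ≤⟨ ι-mono-≤ (ℕ.≤-trans (ℕ.≤-reflexive (eq₁ (suc n) volume)) trials-lower) ⟩
          ι (trials ℕ.* density)                       ≡⟨ ι-* trials density ⟩
          ι trials * ι density
            ≤⟨ *-monoˡ-≤ (0≤ι trials) (density≤success F∈kCNF) ⟩
          ι trials * (ι X * p)                         ≡⟨ eq₂ (ι trials) (ι X) p ⟩
          ι X * (ι trials * p)                         ∎)
          where
          open ≤-Reasoning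
          X = suc n ℕ.^ 2 ℕ.* (3 ℕ.* volume)
          X≢0 : NonZero X
          X≢0 = ℕ.m*n≢0 (suc n ℕ.^ 2) (3 ℕ.* volume) {{ℕ.m^n≢0 (suc n) 2}}
            {{ℕ.m*n≢0 3 volume {{_}} {{ℕ.m*n≢0 (2 ℕ.^ n) (K ℕ.^ n) {{ℕ.m^n≢0 2 n}} {{ℕ.m^n≢0 K n}}}}}}
          eq₁ : ∀ a b → a ℕ.* (a ℕ.* 1) ℕ.* (3 ℕ.* b) ℕ.* a ≡ 3 ℕ.* (a ℕ.* (a ℕ.* (a ℕ.* 1))) ℕ.* b
          eq₁ = solve-∀
          eq₂ : ∀ a b c → a * (b * c) ≡ b * (a * c)
          eq₂ = solve 3 (λ a b c → a :* (b :* c) := b :* (a :* c)) refl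
            where open +-*-Solver

        success-schöning : .{{NonZero n}} → Is suc K CNF F → ∀ {ε} → 1ℚ ≤ ι (suc n) * ε →
          1ℚ - ε ≤ PrSuccessWithin trials F
        success-schöning F∈kCNF {ε} 1≤[1+n]ε = begin
          1ℚ - ε                          ≤⟨ +-monoʳ-≤ 1ℚ (neg-antimono-≤ v≤ε) ⟩
          1ℚ - v                          ≡⟨ eq (PrSuccessWithin trials F) ⟩
          PrSuccessWithin trials F        ∎
          where
          open ≤-Reasoning
          v = failure F (schöning F trials)
          eq : ∀ a → 1ℚ - (1ℚ - a) ≡ a
          eq = solve 1 (λ a → con 1ℚ :- (con 1ℚ :- a) := a) refl
            where open +-*-Solver
          v≤ε : v ≤ ε
          v≤ε = ι-*-cancel-≤ (suc n) (begin
            ι (suc n) * v                                          ≡⟨ *-comm (ι (suc n)) v ⟩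
            v * ι (suc n)
              ≤⟨ *-monoˡ-≤ (0≤fail (succeeds? F) (schöning F trials)) (suc≤trials*p F∈kCNF) ⟩
            v * (ι trials * p)
              ≤⟨ *-monoˡ-≤ (0≤fail (succeeds? F) (schöning F trials))
                (≤-trans (≤-reflexive (sym (+-identityˡ _))) (+-monoˡ-≤ (ι trials * p) 0≤1)) ⟩
            v * (1ℚ + ι trials * p)
              ≡⟨ cong (_* (1ℚ + ι trials * p)) (failure-schöning F trials) ⟩
            failure F (iteration F) ^ trials * (1ℚ + ι trials * p)
              ≤⟨ bernoulli (0≤Pr (succeeds? F) (iteration F)) (0≤fail (succeeds? F) (iteration F)) trials ⟩
            1ℚ                                                     ≤⟨ 1≤[1+n]ε ⟩
            ι (suc n) * ε                                          ∎)

  -- The numerator of a positive rational is at least 1.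
  1/↧≤ : ∀ ε → 0ℚ < ε → (ℤ.+ 1 / ↧ₙ ε) ≤ ε
  1/↧≤ ε@(mkℚ (ℤ.+ suc a) d-1 _) _ = toℚᵘ-cancel-≤ (ℚᵘ.≤-respˡ-≃ (ℚᵘ.≃-sym (toℚᵘ-fromℚᵘ (ℚᵘ.mkℚᵘ (ℤ.+ 1) d-1)))
    (ℚᵘ.*≤* (ℤ.*-monoʳ-≤-nonNeg (ℤ.+ suc d-1) {ℤ.+ 1} {ℤ.+ suc a} (ℤ.+≤+ (s≤s z≤n)))))
  1/↧≤ (mkℚ (ℤ.+ zero) d-1 c) 0<ε with positive {mkℚ (ℤ.+ zero) d-1 c} 0<ε
  ... | ()
  1/↧≤ (mkℚ (ℤ.-[1+ a ]) d-1 c) 0<ε with positive {mkℚ (ℤ.-[1+ a ]) d-1 c} 0<ε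
  ... | ()

  ↧≤⇒1≤ : ∀ ε → 0ℚ < ε → ∀ {m} → ↧ₙ ε ℕ.≤ m → 1ℚ ≤ ι m * ε
  ↧≤⇒1≤ ε@record{} 0<ε {m} d≤m = begin
    1ℚ                          ≡⟨ ι-*-inverse (↧ₙ ε) ⟨
    ι (↧ₙ ε) * (ℤ.+ 1 / ↧ₙ ε)   ≤⟨ *-monoˡ-≤ (0≤ι (↧ₙ ε)) (1/↧≤ ε 0<ε) ⟩
    ι (↧ₙ ε) * ε                ≤⟨ *-monoʳ-≤ (<⇒≤ 0<ε) (ι-mono-≤ d≤m) ⟩
    ι m * ε                     ∎
    where open ≤-Reasoning

-- Assembly of the theorem

open Rationals
open Iterations

open import Defs
open import Data.Nat.Base using (ℕ; suc; _≤_; NonZero; z≤n; s≤s)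
import Data.Nat.Base as ℕ
import Data.Nat.Properties as ℕ
open import Data.Product.Base using (Σ-syntax; ∃-syntax; _×_; _,_)
open import Data.Rational.Base using (ℚ; 0ℚ; 1ℚ; _*_; _-_)
import Data.Rational.Base as ℚ
open import Relation.Binary.PropositionalEquality using (subst₂)

theorem38 : ∀ (k : ℕ) .{{_ : NonZero k}} → 3 ≤ k →
    Σ[ T ∈ (∀ {n} → CNF n → ℕ) ]
    (∃[ c ] ∃[ d ] ∀ {n} (F : CNF n) → Is k CNF F → (sat : Satisfiable F) →
    fromℕ (T F) ℚ.≤ fromℕ (c ℕ.* suc n ℕ.^ d) * bound k F sat)
    × (∀ (ε : ℚ) → 0ℚ ℚ.< ε →
    ∃[ n₀ ] ∀ {n} → n₀ ≤ n → (F : CNF n) → Is k CNF F → Satisfiable F →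
    1ℚ - ε ℚ.≤ PrSuccessWithin (T F) F)
theorem38 (suc K) (s≤s 2≤K) =
  trials 2≤K ,
  (4 , 3 , λ {n} F _ sat → subst₂ (λ a b → a ℚ.≤ b * bound (suc K) F sat)
    (ι≡fromℕ (trials 2≤K F)) (ι≡fromℕ (4 ℕ.* suc n ℕ.^ 3)) (trials≤bound 2≤K F sat)) ,
  -- The denominator of ε serves as n₀: it gives (n+1) ε ≥ 1, and being positive it also excludes n
  -- = 0.
  λ ε 0<ε → ℚ.↧ₙ ε , λ {n} n₀≤n F F∈kCNF sat →
    success-schöning 2≤K F sat {{ℕ.>-nonZero (ℕ.<-≤-trans (s≤s z≤n) n₀≤n)}} F∈kCNF
      (↧≤⇒1≤ ε 0<ε (ℕ.m≤n⇒m≤1+n n₀≤n))
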